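{- Let $G$ be a cactus with at least two blocks. Then, for the Maker-Breaker total domination game: (i) $G$ is ${\cal D}$ if and only if $V(G)$ can be partitioned into $4$-element sets each of which induces a cycle $C_4$; (ii) $G$ is ${\cal N}$ if and only if there exists a sequence of end-blocks isomorphic to $C_4$ such that iteratively removing them yields an ${\cal N}$-star cactus. Consequently, $G$ is ${\cal S}$ in all other cases.
   Context: All graphs are finite and simple. The Maker-Breaker total domination (MBTD) game on a graph $G$ is played by Dominator and Staller, who alternately select a vertex of $G$ not selected before. Dominator wins if at some point the set of vertices he has selected is a total dominating set of $G$ (every vertex of $G$ has a neighbour in it); otherwise Staller wins, equivalently if she selects all vertices of the open neighbourhood of some vertex. The D-game is the game where Dominator moves first, the S-game where Staller moves first. A graph is ${\cal D}$ if Dominator has a winning strategy in both games, ${\cal S}$ if Staller has a winning strategy in both, and ${\cal N}$ if the first player wins (Dominator wins the D-game and Staller wins the S-game); the empty graph is considered ${\cal D}$. A cactus is a connected graph each of whose blocks is a cycle or $K_2$. An end-block of a graph is a block intersecting the other blocks in at most one vertex. Removing an end-block $C$ isomorphic to $C_4$ means deleting all four vertices of $C$. A star cactus is a cactus containing a vertex that lies in every block. An ${\cal N}$-star cactus is a cactus $G$ such that either $G=C_3$, or $G$ is a star cactus with at least two blocks, all cycles of $G$ have length at most $5$, and $G$ contains a $3$-cycle, or a $4$-cycle, or two blocks isomorphic to $K_2$. -}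

module Defs where

open import Data.Nat using (ℕ; zero; suc; _≤_)
open import Data.Bool using (Bool; true; false; if_then_else_)
open import Data.Fin using (Fin; toℕ; _≟_)
open import Data.Fin.Subset using (Subset; _∈_; _∉_; _⊆_; _─_; _-_; ⊤)
open import Data.Product using (Σ; ∃; _×_; _,_)
open import Data.Sum using (_⊎_)
open import Relation.Binary.PropositionalEquality using (_≡_; _≢_)
open import Relation.Nullary using (¬_)
open import Relation.Nullary.Decidable using (⌊_⌋)
open import Function.Bundles using (_⇔_)
open import Function.Definitions using (Injective)

record Graph : Set where
  field
    n     : ℕ
    E     : Fin n → Fin n → Bool
    sym   : ∀ x y → E x y ≡ E y x
    irrefl : ∀ x → E x x ≡ false

CycAdj : (k : ℕ) → Fin k → Fin k → Set
CycAdj k i j =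
  (toℕ j ≡ suc (toℕ i)) ⊎ (toℕ i ≡ suc (toℕ j))
  ⊎ ((toℕ i ≡ 0 × suc (toℕ j) ≡ k) ⊎ (toℕ j ≡ 0 × suc (toℕ i) ≡ k))

module _ (G : Graph) where
  open Graph G

  Adj : Fin n → Fin n → Set
  Adj x y = E x y ≡ true

  -- Induced subgraphs are described by vertex subsets S : Subset n;
  -- G[S] is the subgraph of G induced by S.

  data Reach (S : Subset n) : Fin n → Fin n → Set where
    here : ∀ {x} → x ∈ S → Reach S x x
    step : ∀ {x z y} → x ∈ S → Adj x z → Reach S z y → Reach S x y

  Connected : Subset n → Set
  Connected S = ∀ x y → x ∈ S → y ∈ S → Reach S x y

  Nonseparable : Subset n → Set
  Nonseparable S = Connected S × (∀ w → w ∈ S → Connected (S - w))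

  -- B is (the vertex set of) a block of G[U]: a maximal connected
  -- subgraph of G[U] without a cut vertex (blocks are induced).
  IsBlock : Subset n → Subset n → Set
  IsBlock U B =
    B ⊆ U × (∃ λ x → x ∈ B) × Nonseparable B
    × (∀ T → B ⊆ T → T ⊆ U → Nonseparable T → T ⊆ B)

  InducesCycle : ℕ → Subset n → Set
  InducesCycle k S =
    Σ (Fin k → Fin n) λ c →
      Injective _≡_ _≡_ c
      × (∀ x → (x ∈ S ⇔ ∃ λ i → c i ≡ x))
      × (∀ i j → (Adj (c i) (c j) ⇔ CycAdj k i j))

  IsK2 : Subset n → Set
  IsK2 S = Σ (Fin n) λ u → Σ (Fin n) λ v →
    u ≢ v × Adj u v × (∀ x → (x ∈ S ⇔ (x ≡ u ⊎ x ≡ v)))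

  HasCycle : Subset n → ℕ → Set
  HasCycle U k =
    3 ≤ k × (Σ (Fin k → Fin n) λ c →
      Injective _≡_ _≡_ c × (∀ i → c i ∈ U)
      × (∀ i j → CycAdj k i j → Adj (c i) (c j)))

  Cactus : Subset n → Set
  Cactus U = Connected U ×
    (∀ B → IsBlock U B → (∃ λ k → 3 ≤ k × InducesCycle k B) ⊎ IsK2 B)

  AtLeastTwoBlocks : Subset n → Set
  AtLeastTwoBlocks U =
    Σ (Subset n) λ B₁ → Σ (Subset n) λ B₂ →
      IsBlock U B₁ × IsBlock U B₂ × B₁ ≢ B₂

  StarCactus : Subset n → Set
  StarCactus U = Cactus U × (∃ λ v → v ∈ U × (∀ B → IsBlock U B → v ∈ B))

  IsEndBlock : Subset n → Subset n → Set
  IsEndBlock U C = IsBlock U C ×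
    (∀ u v → u ∈ C → v ∈ C
      → (Σ (Subset n) λ B → IsBlock U B × B ≢ C × u ∈ B)
      → (Σ (Subset n) λ B → IsBlock U B × B ≢ C × v ∈ B)
      → u ≡ v)

  NStarCactus : Subset n → Set
  NStarCactus U =
    InducesCycle 3 U
    ⊎ (StarCactus U × AtLeastTwoBlocks U
       × (∀ k → HasCycle U k → k ≤ 5)
       × (HasCycle U 3 ⊎ HasCycle U 4
          ⊎ (Σ (Subset n) λ B₁ → Σ (Subset n) λ B₂ →
               IsBlock U B₁ × IsBlock U B₂ × B₁ ≢ B₂ × IsK2 B₁ × IsK2 B₂)))

  data Reduces : Subset n → Subset n → Set where
    stop : ∀ {U} → Reduces U U
    remove : ∀ {U W} (C : Subset n) → IsEndBlock U C → InducesCycle 4 C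
           → Reduces (U ─ C) W → Reduces U W

  C4Partition : Set
  C4Partition =
    Σ ℕ λ m → Σ (Fin m → Subset n) λ P →
      (∀ i → InducesCycle 4 (P i))
      × (∀ x → ∃ λ i → x ∈ P i)
      × (∀ x i j → x ∈ P i → x ∈ P j → i ≡ j)

  data Owner : Set where
    free dom sta : Owner

  data Turn : Set where
    D-turn S-turn : Turn

  Position : Set
  Position = Fin n → Owner

  start : Position
  start _ = free

  claim : Position → Fin n → Owner → Position
  claim p v o x = if ⌊ x ≟ v ⌋ then o else p x

  DomDone : Position → Set
  DomDone p = ∀ x → ∃ λ y → Adj x y × p y ≡ dom

  StaDone : Position → Set
  StaDone p = ∃ λ x → ∀ y → Adj x y → p y ≡ sta

  data DomWins : Position → Turn → Set where
    won   : ∀ {p t} → DomDone p → DomWins p t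
    dmove : ∀ {p} v → p v ≡ free → DomWins (claim p v dom) S-turn
          → DomWins p D-turn
    smove : ∀ {p} → (∃ λ v → p v ≡ free)
          → (∀ v → p v ≡ free → DomWins (claim p v sta) D-turn)
          → DomWins p S-turn

  data StaWins : Position → Turn → Set where
    won   : ∀ {p t} → StaDone p → StaWins p t
    smove : ∀ {p} v → p v ≡ free → StaWins (claim p v sta) D-turn
          → StaWins p S-turn
    dmove : ∀ {p} → (∃ λ v → p v ≡ free)
          → (∀ v → p v ≡ free → StaWins (claim p v dom) S-turn)
          → StaWins p D-turn

  IsD IsN IsS : Set
  IsD = DomWins start D-turn × DomWins start S-turn
  IsN = DomWins start D-turn × StaWins start S-turn
  IsS = StaWins start D-turn × StaWins start S-turn

-- The outcome of the game on G[U] is found by induction on U.  A branch of U at a vertex w with fewest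
-- vertices spans an end-block, so end-blocks can be found avoiding any given vertex.  If Staller does not
-- win the D-game on U, let v be a good first move of Dominator.  At an end-block avoiding v Staller, now
-- on move, has a double threat unless the block is a C₄; an attached C₄ can be played out by forcing moves
-- in which Staller gets the attaching vertex, so it can be deleted and the induction applies.  Otherwise
-- every block contains v, so U is a star cactus centred at v: cycles of length at least 6 give Staller a
-- double threat, and if there are only pentagons and at most one K₂ she claims all neighbours of v by
-- forcing moves.  Conversely Dominator wins by pairing strategies: opposite vertices of each C₄, and in an
-- 𝒩-star cactus, after playing the centre, the neighbourhoods of the vertices not yet dominated.

module Submission where

open import Defs
open import Data.Bool using (Bool; true)
import Data.Bool.Properties as Bool
open import Data.Empty using (⊥; ⊥-elim)
open import Data.Fin using (Fin; zero; suc; _≟_; toℕ)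
open import Data.Fin.Properties using (any?; toℕ<n; toℕ-injective; toℕ-fromℕ<; injective⇒≤)
open import Data.Fin.Subset using (Subset; _∈_; _∉_; _⊆_; _⊂_; _⊃_; _─_; _-_; _∪_; ⁅_⁆; ⊤) renaming (⊥ to ∅)
open import Data.Fin.Subset.Induction using (⊂-wellFounded; ⊃-wellFounded)
open import Data.Fin.Subset.Properties
  using (_∈?_; _⊆?_; anySubset?; nonempty?; x∈⁅x⁆; x∈⁅y⁆⇒x≡y; x∈p∧x∉q⇒x∈p─q; p─q⊆p; x∈p∧x≢y⇒x∈p-y;
         x∈p⇒p-x⊂p; p∩q≢∅⇒p─q⊂p; x∈p∩q⁺; x∈p∪q⁺; x∈p∪q⁻; ⊆-antisym; ⊆-⊂-trans; ∈⊤; ∉⊥)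
open import Data.Nat as ℕ using (ℕ; _+_; _∸_; _≤_; _<_; s≤s; z≤n)
open import Data.Nat.DivMod
  using (_%_; _/_; _mod_; m%n<n; m≡m%n+[m/n]*n; [m+kn]%n≡m%n; m<n⇒m%n≡m; n%n≡0; %-distribˡ-+; m%n%n≡m%n; [m+n]%n≡m%n)
import Data.Nat.Properties as ℕ
open import Data.Product using (Σ; ∃; _×_; _,_; proj₁; proj₂)
open import Data.Sum using (_⊎_; inj₁; inj₂; [_,_]′; swap)
open import Data.Unit using () renaming (⊤ to One)
open import Data.Vec as Vec using (_∷_; here; there)
open import Data.Vec.Properties using (lookup∘tabulate; lookup⇒[]=; []=⇒lookup)
open import Function using (_∘_; id)
open import Function.Bundles using (_⇔_; mk⇔; Equivalence)
open import Function.Definitions using (Injective)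
open import Induction.WellFounded using (Acc; acc)
open import Relation.Binary.PropositionalEquality
  using (_≡_; _≢_; refl; sym; trans; cong; subst; module ≡-Reasoning)
open import Relation.Nullary using (¬_; Dec; yes; no; contradiction; does)
open import Relation.Nullary.Decidable using (_×-dec_; ¬?; toSum; map′; dec-true; True; toWitness)

open Equivalence using (to; from)

-- Deleting a `C₄` also deletes its attaching vertex, so the sets `U` met in the induction need not
-- induce cacti: `G[U]` may be disconnected, have isolated vertices, and contain paths left over
-- from broken cycles. Hence nothing is assumed about `U`. Only the whole graph is a cactus, and the
-- nonseparable pieces of `G[U]` are classified by extending them to blocks of `G`.
--
-- Staller's wins are built directly. Dominator's wins are proved by contraposition: a pairing turns
-- a win of Staller into a win of hers in a smaller position, in the end one without undominated
-- vertices, which is absurd. Since `SW` is decidable, refuting it does yield a strategy for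
-- Dominator.
--
-- The induction only produces one of three outcomes for each `U`. That they exclude each other, and
-- so both equivalences, follows from the converse implications and the fact that no game is won by
-- both players.

-- `A i` and `B i` need neither be decidable nor exclude each other: a loop over all vertices either
-- collects an `A` everywhere or stops at one `B`. Sometimes `B` is constant and is the goal itself.
search : ∀ {m} {A B : Fin m → Set} → (∀ i → A i ⊎ B i) → (∀ i → A i) ⊎ ∃ B
search {ℕ.zero} f = inj₁ λ ()
search {ℕ.suc m} f with f zero
... | inj₂ b = inj₂ (zero , b)
... | inj₁ a with search (f ∘ suc)
...   | inj₂ (i , b) = inj₂ (suc i , b)
...   | inj₁ as = inj₁ λ { zero → a ; (suc i) → as i }

∈-tabulate : ∀ {m} {f : Fin m → Bool} {x} → f x ≡ true → x ∈ Vec.tabulate f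
∈-tabulate {f = f} {x} eq = lookup⇒[]= x _ (trans (lookup∘tabulate f x) eq)

∈-tabulate⁻ : ∀ {m} {f : Fin m → Bool} {x} → x ∈ Vec.tabulate f → f x ≡ true
∈-tabulate⁻ {f = f} {x} x∈ = trans (sym (lookup∘tabulate f x)) ([]=⇒lookup x∈)

x∈p─q⇒x∉q : ∀ {m} {p q : Subset m} {x} → x ∈ p ─ q → x ∉ q
x∈p─q⇒x∉q {p = _ ∷ _} {true ∷ _} () here
x∈p─q⇒x∉q {p = _ ∷ _} {_ ∷ _} (there x∈) (there x∈q) = x∈p─q⇒x∉q x∈ x∈q

module _ {m : ℕ} {p : Subset m} where
  ─-∈ : ∀ {q x} → x ∈ p ─ q → x ∈ p
  ─-∈ {q} = p─q⊆p p q

  -∈ : ∀ {y x} → x ∈ p - y → x ∈ p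
  -∈ {y} = p─q⊆p p ⁅ y ⁆

  -≢ : ∀ {y x} → x ∈ p - y → x ≢ y
  -≢ {y} x∈ refl = x∈p─q⇒x∉q x∈ (x∈⁅x⁆ y)

-- The game reduced to free and undominated vertices

module _ (G : Graph) where
  open Graph G renaming (sym to E-sym)

  infix 4 _~_

  _~_ : Fin n → Fin n → Set
  x ~ y = Adj G x y

  ~-sym : ∀ {x y} → x ~ y → y ~ x
  ~-sym {x} {y} = trans (E-sym y x)

  ~-≢ : ∀ {x y} → x ~ y → x ≢ y
  ~-≢ {x} a refl with trans (sym a) (irrefl x)
  ... | ()

  _~?_ : ∀ x y → Dec (x ~ y)
  x ~? y = E x y Bool.≟ true

  N : Fin n → Subset n
  N y = Vec.tabulate (E y)

  ∈N : ∀ {x y} → x ~ y → x ∈ N y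
  ∈N a = ∈-tabulate (~-sym a)

  ∈N⁻ : ∀ {x y} → x ∈ N y → x ~ y
  ∈N⁻ x∈ = ~-sym (∈-tabulate⁻ x∈)

  ∈─N : ∀ {A x y} → x ∈ A → ¬ x ~ y → x ∈ A ─ N y
  ∈─N x∈ na = x∈p∧x∉q⇒x∈p─q x∈ (na ∘ ∈N⁻)

  ∈─N⁻ : ∀ {A : Subset n} {x y} → x ∈ A ─ N y → ¬ x ~ y
  ∈─N⁻ x∈ a = x∈p─q⇒x∉q x∈ (∈N a)

  -- The outcome of a position depends only on the set F of free vertices and
  -- the set A of vertices without a neighbour selected by Dominator.
  -- SW F A t: Staller wins from (F , A); the subgame on G[U] starts at (U , U).
  data SW : Subset n → Subset n → Turn G → Set where
    won   : ∀ {F A t x} → x ∈ A → (∀ y → x ~ y → y ∉ F) → SW F A t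
    smove : ∀ {F A y} → y ∈ F → SW (F - y) A D-turn → SW F A S-turn
    dmove : ∀ {F A} → (∃ λ y → y ∈ F) → (∀ y → y ∈ F → SW (F - y) (A ─ N y) S-turn)
          → SW F A D-turn

  SW⇒nonempty : ∀ {F A t} → SW F A t → ∃ λ x → x ∈ A
  SW⇒nonempty (won x∈A _) = _ , x∈A
  SW⇒nonempty (smove _ d) = SW⇒nonempty d
  SW⇒nonempty (dmove (y , y∈F) f) with SW⇒nonempty (f y y∈F)
  ... | x , x∈ = x , ─-∈ x∈

  data _≼_ : Turn G → Turn G → Set where
    D≼D : D-turn ≼ D-turn
    S≼S : S-turn ≼ S-turn
    D≼S : D-turn ≼ S-turn

  -- Staller loses nothing if more vertices are undominated, if fewer free vertices are adjacent to
  -- `A`, or if it is her turn. Free vertices without a neighbour in `A` are unrestricted, so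
  -- vertices irrelevant to her plan may be added or dropped.
  SW-mono : ∀ {F A t F′ A′ t′} → SW F A t → t ≼ t′ → A ⊆ A′
          → (∀ {x y} → x ∈ A → x ~ y → y ∈ F′ → y ∈ F) → SW F′ A′ t′
  SW-mono {F′ = F′₀} s₀ = go s₀ (⊂-wellFounded F′₀)
    where
    dead : ∀ {F A t F′ A′ t′} → SW F A t → A ⊆ A′ → ¬ (∃ λ y → y ∈ F′) → SW F′ A′ t′
    dead s sub ∄ with SW⇒nonempty s
    ... | x , x∈A = won (sub x∈A) λ y _ y∈ → ∄ (y , y∈)

    go : ∀ {F A t F′ A′ t′} → SW F A t → Acc _⊂_ F′ → t ≼ t′ → A ⊆ A′
       → (∀ {x y} → x ∈ A → x ~ y → y ∈ F′ → y ∈ F) → SW F′ A′ t′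
    go (won x∈A h) _ _ sub rel = won (sub x∈A) λ y a y∈ → h y a (rel x∈A a y∈)
    go {F′ = F′} (smove {y = y} y∈F d) (acc rs) S≼S sub rel with y ∈? F′
    ... | yes y∈F′ = smove y∈F′ (go d (rs (x∈p⇒p-x⊂p y∈F′)) D≼D sub
            λ x∈ a z∈ → x∈p∧x≢y⇒x∈p-y (rel x∈ a (-∈ z∈)) (-≢ z∈))
    ... | no y∉F′ = go d (acc rs) D≼S sub
            λ x∈ a z∈ → x∈p∧x≢y⇒x∈p-y (rel x∈ a z∈) λ { refl → y∉F′ z∈ }
    go {F = F} {A = A} {F′ = F′} d@(dmove ne f) (acc rs) D≼D sub rel =
      [_,_]′ (λ ne′ → dmove ne′ λ y y∈F′ →
      [ (λ y∈F → go (f y y∈F) (rs (x∈p⇒p-x⊂p y∈F′)) S≼S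
          (λ x∈ → ∈─N (sub (─-∈ x∈)) (∈─N⁻ x∈))
          λ x∈ a z∈ → x∈p∧x≢y⇒x∈p-y (rel (─-∈ x∈) a (-∈ z∈)) (-≢ z∈))
      -- By `rel`, a vertex outside `F` has no neighbour in `A`: Dominator has wasted his move.
      , (λ y∉F → go d (rs (x∈p⇒p-x⊂p y∈F′)) D≼S
          (λ x∈ → ∈─N (sub x∈) λ a → y∉F (rel x∈ a y∈F′))
          λ x∈ a z∈ → rel x∈ a (-∈ z∈))
      ]′ (toSum (y ∈? F))) (dead d sub) (toSum (nonempty? F′))
    go {F′ = F′} d@(dmove ne f) (acc rs) D≼S sub rel =
      [ (λ (y , y∈F′) → smove y∈F′ (go d (rs (x∈p⇒p-x⊂p y∈F′)) D≼D sub λ x∈ a z∈ → rel x∈ a (-∈ z∈)))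
      , dead d sub
      ]′ (toSum (nonempty? F′))

  SW-D⇒S : ∀ {F A} → SW F A D-turn → SW F A S-turn
  SW-D⇒S s = SW-mono s D≼S id λ _ _ y∈ → y∈

  SW-afterD : ∀ {F A y} → y ∈ F → SW F A D-turn → SW (F - y) (A ─ N y) S-turn
  SW-afterD y∈ (won x∈A h) = won (∈─N x∈A λ a → h _ a y∈) λ z a z∈ → h z a (-∈ z∈)
  SW-afterD y∈ (dmove _ f) = f _ y∈

  -- Stands in for excluded middle: it yields the case distinction of the induction and the
  -- determinacy of the game.
  SW? : ∀ F A t → SW F A t ⊎ ¬ SW F A t
  SW? F A t = go F A t (⊂-wellFounded F)
    where
    won? : ∀ F A → ∀ x → ¬ (x ∈ A × ∀ y → x ~ y → y ∉ F) ⊎ (x ∈ A × ∀ y → x ~ y → y ∉ F)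
    won? F A x with x ∈? A
    ... | no x∉ = inj₁ (x∉ ∘ proj₁)
    ... | yes x∈ with search {A = λ y → x ~ y → y ∉ F} {B = λ y → x ~ y × y ∈ F} check
      where
      check : ∀ y → (x ~ y → y ∉ F) ⊎ (x ~ y × y ∈ F)
      check y with x ~? y | y ∈? F
      ... | yes a | yes y∈ = inj₂ (a , y∈)
      ... | no na | _ = inj₁ λ a → contradiction a na
      ... | yes _ | no y∉ = inj₁ λ _ → y∉
    ...   | inj₁ h = inj₂ (x∈ , h)
    ...   | inj₂ (y , a , y∈) = inj₁ λ (_ , h) → h y a y∈

    go : ∀ F A t → Acc _⊂_ F → SW F A t ⊎ ¬ SW F A t
    go F A t a with search (won? F A)
    ... | inj₂ (x , x∈ , h) = inj₁ (won x∈ h)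
    go F A S-turn (acc rs) | inj₁ nw with search {A = λ y → y ∈ F → ¬ SW (F - y) A D-turn}
                                              {B = λ y → y ∈ F × SW (F - y) A D-turn} try
      where
      try : ∀ y → (y ∈ F → ¬ SW (F - y) A D-turn) ⊎ (y ∈ F × SW (F - y) A D-turn)
      try y with y ∈? F
      ... | no y∉ = inj₁ λ y∈ → contradiction y∈ y∉
      ... | yes y∈ with go (F - y) A D-turn (rs (x∈p⇒p-x⊂p y∈))
      ...   | inj₁ s = inj₂ (y∈ , s)
      ...   | inj₂ ns = inj₁ λ _ → ns
    ... | inj₁ h = inj₂ λ { (won x∈ w) → nw _ (x∈ , w) ; (smove y∈ d) → h _ y∈ d }
    ... | inj₂ (y , y∈ , s) = inj₁ (smove y∈ s)
    go F A D-turn (acc rs) | inj₁ nw with nonempty? F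
    ... | no ∄ = inj₂ λ { (won x∈ w) → nw _ (x∈ , w) ; (dmove ne _) → ∄ ne }
    ... | yes ne with search {A = λ y → y ∈ F → SW (F - y) (A ─ N y) S-turn}
                             {B = λ y → y ∈ F × ¬ SW (F - y) (A ─ N y) S-turn} try
      where
      try : ∀ y → (y ∈ F → SW (F - y) (A ─ N y) S-turn) ⊎ (y ∈ F × ¬ SW (F - y) (A ─ N y) S-turn)
      try y with y ∈? F
      ... | no y∉ = inj₁ λ y∈ → contradiction y∈ y∉
      ... | yes y∈ with go (F - y) (A ─ N y) S-turn (rs (x∈p⇒p-x⊂p y∈))
      ...   | inj₁ s = inj₁ λ _ → s
      ...   | inj₂ ns = inj₂ (y∈ , ns)
    ...   | inj₁ f = inj₁ (dmove ne f)
    ...   | inj₂ (y , y∈ , ns) = inj₂ λ { (won x∈ w) → nw _ (x∈ , w) ; (dmove _ f) → ns (f y y∈) }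

  ¬SW⇒Dmove : ∀ {F A} → (∃ λ y → y ∈ F) → ¬ SW F A D-turn
            → ∃ λ y → y ∈ F × ¬ SW (F - y) (A ─ N y) S-turn
  ¬SW⇒Dmove {F} {A} ne ns with search {A = λ y → y ∈ F → SW (F - y) (A ─ N y) S-turn}
                             {B = λ y → y ∈ F × ¬ SW (F - y) (A ─ N y) S-turn} try
    where
    try : ∀ y → (y ∈ F → SW (F - y) (A ─ N y) S-turn) ⊎ (y ∈ F × ¬ SW (F - y) (A ─ N y) S-turn)
    try y with y ∈? F
    ... | no y∉ = inj₁ λ y∈ → contradiction y∈ y∉
    ... | yes y∈ with SW? (F - y) (A ─ N y) S-turn
    ...   | inj₁ s = inj₁ λ _ → s
    ...   | inj₂ ns = inj₂ (y∈ , ns)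
  ... | inj₁ f = contradiction (dmove ne f) ns
  ... | inj₂ r = r

  -- Staller's threats

  -- Only an upper bound: `u` and `t` may coincide or may no longer be free. The threat lemmas
  -- dispose of these degenerate cases by `threat₁`.
  NbrsIn : Subset n → Fin n → Fin n → Fin n → Set
  NbrsIn F x u t = ∀ {y} → x ~ y → y ∈ F → y ≡ u ⊎ y ≡ t

  threat₁ : ∀ {F A x t} → x ∈ A → (∀ {y} → x ~ y → y ∈ F → y ≡ t) → SW F A S-turn
  threat₁ {F} {A} {x} {t} x∈A h with t ∈? F
  ... | no t∉ = won x∈A λ { y a y∈ → t∉ (subst (_∈ F) (h a y∈) y∈) }
  ... | yes t∈ = smove t∈ (won x∈A λ y a y∈ → -≢ y∈ (h a (-∈ y∈)))

  -- A forcing move: Staller takes `u`, and unless Dominator answers at `t` she completes the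
  -- neighbourhood of `x`. It therefore suffices to win after both moves.
  threat₂ : ∀ {F A x u t} → x ∈ A → NbrsIn F x u t
          → SW (F - u - t) (A ─ N t) S-turn → SW F A S-turn
  threat₂ {F} {A} {x} {u} {t} x∈A h s with u ∈? F | u ≟ t
  ... | no u∉ | _ = threat₁ x∈A λ a y∈ → [ (λ { refl → contradiction y∈ u∉ }) , id ]′ (h a y∈)
  ... | yes u∈ | yes refl = threat₁ x∈A λ a y∈ → [ id , id ]′ (h a y∈)
  ... | yes u∈ | no u≢t with t ∈? F
  ...   | no t∉ = threat₁ x∈A λ a y∈ → [ id , (λ { refl → contradiction y∈ t∉ }) ]′ (h a y∈)
  ...   | yes t∈ = smove u∈ (dmove (t , x∈p∧x≢y⇒x∈p-y t∈ (u≢t ∘ sym)) reply)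
    where
    reply : ∀ y → y ∈ F - u → SW (F - u - y) (A ─ N y) S-turn
    reply y y∈ with y ≟ t
    ... | yes refl = s
    ... | no y≢t = threat₁ {t = t} (∈─N x∈A λ a → [ -≢ y∈ , y≢t ]′ (h a (-∈ y∈)))
          λ a z∈ → [ (λ e → contradiction e (-≢ (-∈ z∈))) , id ]′ (h a (-∈ (-∈ z∈)))

  -- The move `u` forces the answer `t`, which is no neighbour of `x′` because it differs from both
  -- `u` and `t′`; Staller then takes `t′`.
  doubleThreat : ∀ {F A x x′ u t t′} → x ∈ A → x′ ∈ A → NbrsIn F x u t → NbrsIn F x′ u t′
               → t ≢ t′ → SW F A S-turn
  doubleThreat {F} {A} {x} {x′} {u} {t} {t′} x∈A x′∈A h h′ t≢t′ with t ∈? F | t ≟ u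
  ... | no t∉ | _ = threat₁ x∈A λ a y∈ → [ id , (λ { refl → contradiction y∈ t∉ }) ]′ (h a y∈)
  ... | yes _ | yes refl = threat₁ x∈A λ a y∈ → [ id , id ]′ (h a y∈)
  ... | yes t∈ | no t≢u = threat₂ x∈A h (threat₁ (∈─N x′∈A λ a → [ t≢u , t≢t′ ]′ (h′ a t∈))
        λ a y∈ → [ (λ e → contradiction e (-≢ (-∈ y∈))) , id ]′ (h′ a (-∈ (-∈ y∈))))

  -- Dominator's pairing strategy

  -- `P x y z` means that the pair `y`, `z` guards `x`. `P-share` replaces disjointness of the
  -- pairs: when Dominator completes a pair, every guarded vertex whose own pair meets it is
  -- dominated at the same time, so the damage to that other pair is harmless.
  module Pairing (P : Fin n → Fin n → Fin n → Set)
    (P-adj : ∀ {x y z} → P x y z → x ~ y × x ~ z × y ≢ z)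
    (P-share : ∀ {x y z x′ y′ z′ s} → P x y z → P x′ y′ z′ → s ≡ y ⊎ s ≡ z → s ≡ y′ ⊎ s ≡ z′
             → x′ ~ y × x′ ~ z)
    where

    -- A vertex is either left to the remaining game or has a pair that is wholly free and wholly
    -- outside `F′`, which play inside `F′` cannot break.
    Paired : Subset n → Subset n → Subset n → Fin n → Set
    Paired F F′ A′ x = x ∈ A′ ⊎ ∃ λ y → ∃ λ z → P x y z × (y ∈ F × z ∈ F) × (y ∉ F′ × z ∉ F′)

    -- Dominator answers moves outside F′ within the pairs, so Staller wins the remaining game (F′ , A′);
    -- for A′ = ∅ this is impossible.
    pairing : ∀ {F A F′ A′ t} → F′ ⊆ F → (∀ x → x ∈ A → Paired F F′ A′ x)
            → SW F A t → SW F′ A′ t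
    pairing sub inv (won {x = x} x∈A h) with inv x x∈A
    ... | inj₁ x∈A′ = won x∈A′ λ y a y∈ → h y a (sub y∈)
    ... | inj₂ (y , z , p , (y∈ , _) , _) = contradiction y∈ (h y (proj₁ (P-adj p)))
    pairing {F} {A} {F′} {A′} sub inv (smove {y = u} u∈F d) with u ∈? F′
    ... | yes u∈F′ = smove u∈F′ (pairing (λ z∈ → x∈p∧x≢y⇒x∈p-y (sub (-∈ z∈)) (-≢ z∈)) inv′ d)
      where
      inv′ : ∀ x → x ∈ A → Paired (F - u) (F′ - u) A′ x
      inv′ x x∈A with inv x x∈A
      ... | inj₁ x∈A′ = inj₁ x∈A′
      ... | inj₂ (y , z , p , (y∈ , z∈) , (y∉ , z∉)) = inj₂ (y , z , p
            , (x∈p∧x≢y⇒x∈p-y y∈ (λ { refl → y∉ u∈F′ }) , x∈p∧x≢y⇒x∈p-y z∈ (λ { refl → z∉ u∈F′ }))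
            , (y∉ ∘ -∈ , z∉ ∘ -∈))
    ... | no u∉F′ = respond (search find) d
      where
      -- The last component is `P-share` read from the pair of `u` and `o`: every vertex whose pair
      -- contains one of them is dominated by `o`.
      Partner : Fin n → Set
      Partner x = ∃ λ o → o ∈ F × o ≢ u × o ∉ F′
                × (∀ {x′ y′ z′ s} → P x′ y′ z′ → s ≡ u ⊎ s ≡ o → s ≡ y′ ⊎ s ≡ z′ → x′ ~ o)

      find : ∀ x → (x ∈ A → Paired (F - u) F′ A′ x) ⊎ Partner x
      find x with x ∈? A
      ... | no x∉ = inj₁ λ x∈ → contradiction x∈ x∉
      ... | yes x∈ with inv x x∈
      ...   | inj₁ x∈A′ = inj₁ λ _ → inj₁ x∈A′
      ...   | inj₂ (y , z , p , (y∈ , z∈) , (y∉ , z∉)) with y ≟ u | z ≟ u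
      ...     | yes refl | _ = inj₂ (z , z∈ , (proj₂ (proj₂ (P-adj p)) ∘ sym) , z∉
                  , λ p′ e e′ → proj₂ (P-share p p′ e e′))
      ...     | no _ | yes refl = inj₂ (y , y∈ , proj₂ (proj₂ (P-adj p)) , y∉
                  , λ p′ e e′ → proj₁ (P-share p p′ ([ inj₂ , inj₁ ]′ e) e′))
      ...     | no y≢ | no z≢ = inj₁ λ _ → inj₂ (y , z , p
                  , (x∈p∧x≢y⇒x∈p-y y∈ y≢ , x∈p∧x≢y⇒x∈p-y z∈ z≢) , (y∉ , z∉))

      sub′ : F′ ⊆ F - u
      sub′ z∈ = x∈p∧x≢y⇒x∈p-y (sub z∈) λ { refl → u∉F′ z∈ }

      respond : (∀ x → x ∈ A → Paired (F - u) F′ A′ x) ⊎ ∃ Partner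
              → SW (F - u) A D-turn → SW F′ A′ S-turn
      -- Staller's move hit no pair that is still needed, so it amounts to a pass in the remaining
      -- game.
      respond (inj₁ inv′) d = SW-D⇒S (pairing sub′ inv′ d)
      respond (inj₂ _) (won {x = x} x∈A h) with inv x x∈A
      ... | inj₁ x∈A′ = won x∈A′ λ y a y∈ → h y a (sub′ y∈)
      ... | inj₂ (y , z , p , (y∈ , z∈) , _) with y ≟ u | P-adj p
      ...   | yes refl | (_ , a , y≢z) = contradiction (x∈p∧x≢y⇒x∈p-y z∈ (y≢z ∘ sym)) (h z a)
      ...   | no y≢u | (a , _) = contradiction (x∈p∧x≢y⇒x∈p-y y∈ y≢u) (h y a)
      respond (inj₂ (_ , o , o∈ , o≢u , o∉ , sh)) (dmove _ f) =
        pairing (λ z∈ → x∈p∧x≢y⇒x∈p-y (sub′ z∈) λ { refl → o∉ z∈ }) inv′ (f o (x∈p∧x≢y⇒x∈p-y o∈ o≢u))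
        where
        inv′ : ∀ x → x ∈ A ─ N o → Paired (F - u - o) F′ A′ x
        inv′ x x∈ with inv x (─-∈ x∈)
        ... | inj₁ x∈A′ = inj₁ x∈A′
        ... | inj₂ (y , z , p , (y∈ , z∈) , y∉z∉) = inj₂ (y , z , p
              , (keep y∈ (inj₁ refl) , keep z∈ (inj₂ refl)) , y∉z∉)
          where
          keep : ∀ {s} → s ∈ F → s ≡ y ⊎ s ≡ z → s ∈ F - u - o
          keep s∈ e = x∈p∧x≢y⇒x∈p-y
            (x∈p∧x≢y⇒x∈p-y s∈ λ s≡u → ∈─N⁻ x∈ (sh p (inj₁ s≡u) e))
            λ s≡o → ∈─N⁻ x∈ (sh p (inj₂ s≡o) e)
    pairing {F} {A} {F′} {A′} sub inv (dmove ne f) with nonempty? F′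
    ... | yes ne′ = dmove ne′ λ y y∈ → pairing
          (λ z∈ → x∈p∧x≢y⇒x∈p-y (sub (-∈ z∈)) (-≢ z∈)) (inv′ y y∈) (f y (sub y∈))
      where
      inv′ : ∀ u → u ∈ F′ → ∀ x → x ∈ A ─ N u → Paired (F - u) (F′ - u) (A′ ─ N u) x
      inv′ u u∈ x x∈ with inv x (─-∈ x∈)
      ... | inj₁ x∈A′ = inj₁ (∈─N x∈A′ (∈─N⁻ x∈))
      ... | inj₂ (y , z , p , (y∈ , z∈) , (y∉ , z∉)) = inj₂ (y , z , p
            , (x∈p∧x≢y⇒x∈p-y y∈ (λ { refl → y∉ u∈ }) , x∈p∧x≢y⇒x∈p-y z∈ (λ { refl → z∉ u∈ }))
            , (y∉ ∘ -∈ , z∉ ∘ -∈))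
    -- With `F′` exhausted, Dominator moves anywhere. If he hits the pair of `x`, he dominates `x`,
    -- so no pair is lost; whatever is left in `A′` then has no free neighbour.
    pairing {F} {A} {F′} {A′} sub inv (dmove (u , u∈) f) | no ∄
      with SW⇒nonempty (pairing {F′ = F′} (λ z∈ → contradiction (_ , z∈) ∄) inv′ (f u u∈))
      where
      inv′ : ∀ x → x ∈ A ─ N u → Paired (F - u) F′ A′ x
      inv′ x x∈ with inv x (─-∈ x∈)
      ... | inj₁ x∈A′ = inj₁ x∈A′
      ... | inj₂ (y , z , p , (y∈ , z∈) , y∉z∉) = inj₂ (y , z , p
            , (x∈p∧x≢y⇒x∈p-y y∈ (λ { refl → ∈─N⁻ x∈ (proj₁ (P-adj p)) })
              , x∈p∧x≢y⇒x∈p-y z∈ (λ { refl → ∈─N⁻ x∈ (proj₁ (proj₂ (P-adj p))) })) , y∉z∉)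
    ... | x , x∈A′ = won x∈A′ λ y _ y∈ → ∄ (y , y∈)

  -- From positions (F , A) to positions on G

  record Rep (p : Position G) (F A : Subset n) : Set where
    field
      free⁺ : ∀ {y} → y ∈ F → p y ≡ free
      free⁻ : ∀ {y} → p y ≡ free → y ∈ F
      undom⁺ : ∀ {x y} → x ∈ A → x ~ y → p y ≢ dom
      undom⁻ : ∀ {x} → (∀ y → x ~ y → p y ≢ dom) → x ∈ A

  open Rep

  claim-≡ : ∀ (p : Position G) v o → claim G p v o v ≡ o
  claim-≡ p v o with v ≟ v
  ... | yes _ = refl
  ... | no v≢ = contradiction refl v≢

  claim-≢ : ∀ (p : Position G) {v x} o → x ≢ v → claim G p v o x ≡ p x
  claim-≢ p {v} {x} o x≢ with x ≟ v
  ... | yes e = contradiction e x≢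
  ... | no _ = refl

  Rep-sta : ∀ {p F A v} → Rep p F A → p v ≡ free → Rep (claim G p v sta) (F - v) A
  Rep-sta {p} {v = v} r v-free = record
    { free⁺ = λ y∈ → trans (claim-≢ p sta (-≢ y∈)) (free⁺ r (-∈ y∈))
    ; free⁻ = fr
    ; undom⁺ = λ x∈ a e → undom⁺ r x∈ a (same e)
    ; undom⁻ = λ h → undom⁻ r λ y a e → h y a (same⁻ e)
    }
    where
    fr : ∀ {y} → claim G p v sta y ≡ free → y ∈ _ - v
    fr {y} e with y ≟ v
    fr {y} () | yes _
    ... | no y≢ = x∈p∧x≢y⇒x∈p-y (free⁻ r e) y≢
    same : ∀ {y} → claim G p v sta y ≡ dom → p y ≡ dom
    same {y} e with y ≟ v
    same () | yes _
    ... | no _ = e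
    same⁻ : ∀ {y} → p y ≡ dom → claim G p v sta y ≡ dom
    same⁻ {y} e with y ≟ v
    ... | no _ = e
    ... | yes refl with trans (sym v-free) e
    ...   | ()

  Rep-dom : ∀ {p F A v} → Rep p F A → p v ≡ free → Rep (claim G p v dom) (F - v) (A ─ N v)
  Rep-dom {p} {v = v} r v-free = record
    { free⁺ = λ y∈ → trans (claim-≢ p dom (-≢ y∈)) (free⁺ r (-∈ y∈))
    ; free⁻ = fr
    ; undom⁺ = und
    ; undom⁻ = λ h → ∈─N (undom⁻ r λ y a e → h y a (mono e)) λ a → h v a (claim-≡ p v dom)
    }
    where
    fr : ∀ {y} → claim G p v dom y ≡ free → y ∈ _ - v
    fr {y} e with y ≟ v
    fr {y} () | yes _
    ... | no y≢ = x∈p∧x≢y⇒x∈p-y (free⁻ r e) y≢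
    mono : ∀ {y} → p y ≡ dom → claim G p v dom y ≡ dom
    mono {y} e with y ≟ v
    ... | no _ = e
    ... | yes _ = refl
    und : ∀ {x y} → x ∈ _ ─ N v → x ~ y → claim G p v dom y ≢ dom
    und {x} {y} x∈ a e with y ≟ v
    ... | yes refl = ∈─N⁻ x∈ a
    ... | no _ = undom⁺ r (─-∈ x∈) a e

  SW⇒StaWins : ∀ {p F A t} → Rep p F A → SW F A t → StaWins G p t
  SW⇒StaWins {p} {F} r (won {x = x} x∈A h) = won (x , own)
    where
    own : ∀ y → x ~ y → p y ≡ sta
    own y a with p y in e
    ... | sta = refl
    ... | free = contradiction (free⁻ r e) (h y a)
    ... | dom = contradiction e (undom⁺ r x∈A a)
  SW⇒StaWins r (smove y∈F d) = smove _ (free⁺ r y∈F) (SW⇒StaWins (Rep-sta r (free⁺ r y∈F)) d)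
  SW⇒StaWins r (dmove (y , y∈) f) = dmove (y , free⁺ r y∈)
    λ v e → SW⇒StaWins (Rep-dom r e) (f v (free⁻ r e))

  -- Dominator preserves `¬ SW`. As long as some vertex is undominated a free vertex must exist,
  -- since otherwise Staller would already have won; so the play ends with `A` empty.
  ¬SW⇒DomWins : ∀ {p F A t} → Rep p F A → ¬ SW F A t → DomWins G p t
  ¬SW⇒DomWins {F = F₀} = go (⊂-wellFounded F₀)
    where
    done : ∀ {p F A} → Rep p F A → ¬ (∃ λ x → x ∈ A) → DomDone G p
    done {p} r ∄ x with search {A = λ y → x ~ y → p y ≢ dom} {B = λ y → x ~ y × p y ≡ dom} check
      where
      check : ∀ y → (x ~ y → p y ≢ dom) ⊎ (x ~ y × p y ≡ dom)
      check y with x ~? y | p y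
      ... | no na | _ = inj₁ λ a → contradiction a na
      ... | yes a | dom = inj₂ (a , refl)
      ... | yes _ | free = inj₁ λ _ ()
      ... | yes _ | sta = inj₁ λ _ ()
    ... | inj₁ h = contradiction (x , undom⁻ r h) ∄
    ... | inj₂ r′ = r′

    go : ∀ {p F A t} → Acc _⊂_ F → Rep p F A → ¬ SW F A t → DomWins G p t
    go {F = F} {A} _ r ns with nonempty? A
    ... | no ∄ = won (done r ∄)
    ... | yes (x , x∈) with nonempty? F
    ...   | no ∄ = contradiction (won x∈ λ y _ y∈ → ∄ (y , y∈)) ns
    go {t = D-turn} (acc rs) r ns | yes _ | yes ne with ¬SW⇒Dmove ne ns
    ... | y , y∈ , ns′ = dmove y (free⁺ r y∈)
          (go (rs (x∈p⇒p-x⊂p y∈)) (Rep-dom r (free⁺ r y∈)) ns′)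
    go {t = S-turn} (acc rs) r ns | yes _ | yes (y , y∈) = smove (y , free⁺ r y∈)
      λ v e → go (rs (x∈p⇒p-x⊂p (free⁻ r e))) (Rep-sta r e) (ns ∘ smove (free⁻ r e))

  Rep-start : Rep (start G) ⊤ ⊤
  Rep-start = record { free⁺ = λ _ → refl ; free⁻ = λ _ → ∈⊤ ; undom⁺ = λ _ _ () ; undom⁻ = λ _ → ∈⊤ }

  -- A derivation of `StaWins` need not stop when Dominator is done, so it has to be followed
  -- through later moves; a total dominating set survives all of them.
  DomDone⇒¬StaWins : ∀ {p t} → DomDone G p → ¬ StaWins G p t
  DomDone⇒¬StaWins dd (won (x , h)) with dd x
  ... | y , a , e with trans (sym e) (h y a)
  ...   | ()
  DomDone⇒¬StaWins {p} dd (smove v e s) = DomDone⇒¬StaWins keep s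
    where
    keep : DomDone G (claim G p v sta)
    keep x with dd x
    ... | y , a , e′ with y ≟ v in eq
    ...   | no y≢ = y , a , trans (claim-≢ p sta y≢) e′
    ...   | yes refl with trans (sym e) e′
    ...     | ()
  DomDone⇒¬StaWins {p} dd (dmove (v , e) f) = DomDone⇒¬StaWins keep (f v e)
    where
    keep : DomDone G (claim G p v dom)
    keep x with dd x
    ... | y , a , e′ with y ≟ v
    ...   | no y≢ = y , a , trans (claim-≢ p dom y≢) e′
    ...   | yes refl = y , a , claim-≡ p y dom

  StaDone⇒¬DomWins : ∀ {p t} → StaDone G p → ¬ DomWins G p t
  StaDone⇒¬DomWins (x , h) (won dd) with dd x
  ... | y , a , e with trans (sym e) (h y a)
  ...   | ()
  StaDone⇒¬DomWins {p} (x , h) (dmove v e d) = StaDone⇒¬DomWins (x , keep) d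
    where
    keep : ∀ y → x ~ y → claim G p v dom y ≡ sta
    keep y a with y ≟ v
    ... | no _ = h y a
    ... | yes refl with trans (sym e) (h y a)
    ...   | ()
  StaDone⇒¬DomWins {p} (x , h) (smove (v , e) f) = StaDone⇒¬DomWins (x , keep) (f v e)
    where
    keep : ∀ y → x ~ y → claim G p v sta y ≡ sta
    keep y a with y ≟ v
    ... | no _ = h y a
    ... | yes refl = refl

  DomWins⇒¬StaWins : ∀ {p t} → DomWins G p t → ¬ StaWins G p t
  DomWins⇒¬StaWins (won dd) s = DomDone⇒¬StaWins dd s
  DomWins⇒¬StaWins d@(dmove _ _ _) (won sd) = StaDone⇒¬DomWins sd d
  DomWins⇒¬StaWins d@(smove _ _) (won sd) = StaDone⇒¬DomWins sd d
  DomWins⇒¬StaWins (dmove v e d) (dmove _ f) = DomWins⇒¬StaWins d (f v e)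
  DomWins⇒¬StaWins (smove _ f) (smove v e s) = DomWins⇒¬StaWins (f v e) s

  -- Connectivity, blocks and end-blocks

  Reach-∈ˡ : ∀ {S x y} → Reach G S x y → x ∈ S
  Reach-∈ˡ (here x∈) = x∈
  Reach-∈ˡ (step x∈ _ _) = x∈

  Reach-∈ʳ : ∀ {S x y} → Reach G S x y → y ∈ S
  Reach-∈ʳ (here x∈) = x∈
  Reach-∈ʳ (step _ _ r) = Reach-∈ʳ r

  Reach-trans : ∀ {S x y z} → Reach G S x y → Reach G S y z → Reach G S x z
  Reach-trans (here _) r = r
  Reach-trans (step x∈ a r′) r = step x∈ a (Reach-trans r′ r)

  Reach-snoc : ∀ {S x y z} → Reach G S x y → y ~ z → z ∈ S → Reach G S x z
  Reach-snoc r a z∈ = Reach-trans r (step (Reach-∈ʳ r) a (here z∈))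

  Reach-sym : ∀ {S x y} → Reach G S x y → Reach G S y x
  Reach-sym (here x∈) = here x∈
  Reach-sym (step x∈ a r) = Reach-snoc (Reach-sym r) (~-sym a) x∈

  Reach-mono : ∀ {S T x y} → S ⊆ T → Reach G S x y → Reach G T x y
  Reach-mono sub (here x∈) = here (sub x∈)
  Reach-mono sub (step x∈ a r) = step (sub x∈) a (Reach-mono sub r)

  ClosedIn : Subset n → Subset n → Set
  ClosedIn S K = ∀ {x y} → x ∈ K → y ∈ S → x ~ y → y ∈ K

  Reach-closed : ∀ {S K x y} → ClosedIn S K → Reach G S x y → x ∈ K → y ∈ K
  Reach-closed cl (here _) x∈ = x∈
  Reach-closed cl (step _ a r) x∈ = Reach-closed cl r (cl x∈ (Reach-∈ˡ r) a)

  Reach-first : ∀ {S x y} → Reach G S x y → x ≢ y → ∃ λ z → z ∈ S × x ~ z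
  Reach-first (here _) x≢ = contradiction refl x≢
  Reach-first (step _ a r) _ = _ , Reach-∈ˡ r , a

  Connected-∪ : ∀ {S T U z} → Connected G S → Connected G T → z ∈ S → z ∈ T
              → S ⊆ U → T ⊆ U → (∀ {x} → x ∈ U → x ∈ S ⊎ x ∈ T) → Connected G U
  Connected-∪ {S} {T} {U} {z} cS cT z∈S z∈T S⊆ T⊆ cov x y x∈ y∈ =
    Reach-trans (toZ x∈) (Reach-sym (toZ y∈))
    where
    toZ : ∀ {x} → x ∈ U → Reach G U x z
    toZ x∈ with cov x∈
    ... | inj₁ x∈S = Reach-mono S⊆ (cS _ _ x∈S z∈S)
    ... | inj₂ x∈T = Reach-mono T⊆ (cT _ _ x∈T z∈T)

  Nonseparable-minus : ∀ {S} → Nonseparable G S → ∀ w → Connected G (S - w)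
  Nonseparable-minus {S} (c , cs) w with w ∈? S
  ... | yes w∈ = cs w w∈
  ... | no w∉ = λ x y x∈ y∈ → Reach-mono (λ z∈ → x∈p∧x≢y⇒x∈p-y z∈ λ { refl → w∉ z∈ })
                                (c x y (-∈ x∈) (-∈ y∈))

  ∪-left : ∀ {S T : Subset n} {x} → x ∈ S → x ∈ S ∪ T
  ∪-left = x∈p∪q⁺ ∘ inj₁

  ∪-right : ∀ {S T : Subset n} {x} → x ∈ T → x ∈ S ∪ T
  ∪-right {S} = x∈p∪q⁺ {p = S} ∘ inj₂

  ∪-cases : ∀ {S T : Subset n} {x} → x ∈ S ∪ T → x ∈ S ⊎ x ∈ T
  ∪-cases {S} {T} = x∈p∪q⁻ S T

  -- Whichever vertex is deleted, `a` or `b` survives and joins the two connected remainders.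
  Nonseparable-∪ : ∀ {S T a b} → Nonseparable G S → Nonseparable G T → a ≢ b
                 → a ∈ S → a ∈ T → b ∈ S → b ∈ T → Nonseparable G (S ∪ T)
  Nonseparable-∪ {S} {T} {a} {b} nS nT a≢b a∈S a∈T b∈S b∈T =
    Connected-∪ (proj₁ nS) (proj₁ nT) a∈S a∈T ∪-left ∪-right ∪-cases , minus
    where
    minus : ∀ w → w ∈ S ∪ T → Connected G ((S ∪ T) - w)
    minus w _ with a ≟ w
    ... | no a≢w = Connected-∪ (Nonseparable-minus nS w) (Nonseparable-minus nT w)
          (x∈p∧x≢y⇒x∈p-y a∈S a≢w) (x∈p∧x≢y⇒x∈p-y a∈T a≢w)
          (λ x∈ → x∈p∧x≢y⇒x∈p-y (∪-left (-∈ x∈)) (-≢ x∈))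
          (λ x∈ → x∈p∧x≢y⇒x∈p-y (∪-right (-∈ x∈)) (-≢ x∈))
          λ x∈ → [ (λ x∈S → inj₁ (x∈p∧x≢y⇒x∈p-y x∈S (-≢ x∈)))
                 , (λ x∈T → inj₂ (x∈p∧x≢y⇒x∈p-y x∈T (-≢ x∈))) ]′ (∪-cases (-∈ x∈))
    ... | yes refl = Connected-∪ (Nonseparable-minus nS w) (Nonseparable-minus nT w)
          (x∈p∧x≢y⇒x∈p-y b∈S (a≢b ∘ sym)) (x∈p∧x≢y⇒x∈p-y b∈T (a≢b ∘ sym))
          (λ x∈ → x∈p∧x≢y⇒x∈p-y (∪-left (-∈ x∈)) (-≢ x∈))
          (λ x∈ → x∈p∧x≢y⇒x∈p-y (∪-right (-∈ x∈)) (-≢ x∈))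
          λ x∈ → [ (λ x∈S → inj₁ (x∈p∧x≢y⇒x∈p-y x∈S (-≢ x∈)))
                 , (λ x∈T → inj₂ (x∈p∧x≢y⇒x∈p-y x∈T (-≢ x∈))) ]′ (∪-cases (-∈ x∈))

  Nonseparable-⁅⁆ : ∀ x → Nonseparable G ⁅ x ⁆
  Nonseparable-⁅⁆ x = conn , λ w w∈ y z y∈ z∈ →
      contradiction (trans (single (-∈ y∈)) (sym (single w∈))) (-≢ y∈)
    where
    single : ∀ {y} → y ∈ ⁅ x ⁆ → y ≡ x
    single {y} = x∈⁅y⁆⇒x≡y x
    conn : Connected G ⁅ x ⁆
    conn y z y∈ z∈ with single y∈ | single z∈
    ... | refl | refl = here y∈

  pair : Fin n → Fin n → Subset n
  pair x y = ⁅ x ⁆ ∪ ⁅ y ⁆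

  ∈-pairˡ : ∀ {x y} → x ∈ pair x y
  ∈-pairˡ {x} = ∪-left (x∈⁅x⁆ x)

  ∈-pairʳ : ∀ {x y} → y ∈ pair x y
  ∈-pairʳ {x} {y} = ∪-right {⁅ x ⁆} (x∈⁅x⁆ y)

  pair-cases : ∀ {x y z} → z ∈ pair x y → z ≡ x ⊎ z ≡ y
  pair-cases {x} {y} z∈ with ∪-cases {⁅ x ⁆} z∈
  ... | inj₁ h = inj₁ (x∈⁅y⁆⇒x≡y x h)
  ... | inj₂ h = inj₂ (x∈⁅y⁆⇒x≡y y h)

  Nonseparable-edge : ∀ {x y} → x ~ y → Nonseparable G (pair x y)
  Nonseparable-edge {x} {y} x~y = conn , minus
    where
    conn : Connected G (pair x y)
    conn a b a∈ b∈ with pair-cases a∈ | pair-cases b∈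
    ... | inj₁ refl | inj₁ refl = here a∈
    ... | inj₁ refl | inj₂ refl = step a∈ x~y (here b∈)
    ... | inj₂ refl | inj₁ refl = step a∈ (~-sym x~y) (here b∈)
    ... | inj₂ refl | inj₂ refl = here a∈
    minus : ∀ w → w ∈ pair x y → Connected G (pair x y - w)
    minus w w∈ a b a∈ b∈ with pair-cases w∈ | pair-cases (-∈ a∈) | pair-cases (-∈ b∈)
    ... | _ | inj₁ refl | inj₁ refl = here a∈
    ... | _ | inj₂ refl | inj₂ refl = here a∈
    ... | inj₁ refl | inj₁ refl | inj₂ refl = contradiction refl (-≢ a∈)
    ... | inj₂ refl | inj₁ refl | inj₂ refl = contradiction refl (-≢ b∈)
    ... | inj₁ refl | inj₂ refl | inj₁ refl = contradiction refl (-≢ b∈)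
    ... | inj₂ refl | inj₂ refl | inj₁ refl = contradiction refl (-≢ a∈)

  record Component (S : Subset n) (x : Fin n) : Set where
    field
      R       : Subset n
      R⊆S     : R ⊆ S
      x∈R     : x ∈ R
      reach   : ∀ {z} → z ∈ R → Reach G S x z
      closed  : ClosedIn S R

  component : ∀ {S x} → x ∈ S → Component S x
  component {S} {x} x∈S = grow ⁅ x ⁆ (⊃-wellFounded _) (x∈⁅x⁆ x) start-reach
    where
    start-reach : ∀ {z} → z ∈ ⁅ x ⁆ → Reach G S x z
    start-reach z∈ with x∈⁅y⁆⇒x≡y x z∈
    ... | refl = here x∈S

    grow : ∀ R → Acc _⊃_ R → x ∈ R → (∀ {z} → z ∈ R → Reach G S x z) → Component S x
    grow R (acc rs) x∈R reach
      with any? (λ z → any? λ y → (z ∈? R) ×-dec (y ∈? S) ×-dec ¬? (y ∈? R) ×-dec (z ~? y))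
    ... | yes (z , y , z∈ , y∈S , y∉R , a) = grow (R ∪ ⁅ y ⁆)
            (rs (∪-left , y , ∪-right {R} (x∈⁅x⁆ y) , y∉R)) (∪-left x∈R) reach′
      where
      reach′ : ∀ {w} → w ∈ R ∪ ⁅ y ⁆ → Reach G S x w
      reach′ w∈ with ∪-cases w∈
      ... | inj₁ w∈R = reach w∈R
      ... | inj₂ w∈y with x∈⁅y⁆⇒x≡y y w∈y
      ...   | refl = Reach-snoc (reach z∈) a y∈S
    ... | no ∄ = record
      { R = R ; R⊆S = Reach-∈ʳ ∘ reach ; x∈R = x∈R ; reach = reach ; closed = closed }
      where
      closed : ClosedIn S R
      closed {z} {y} z∈ y∈ a with y ∈? R
      ... | yes y∈R = y∈R
      ... | no y∉R = contradiction (z , y , z∈ , y∈ , y∉R , a) ∄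

  -- Positive evidence of disconnectedness. The closed side `P` itself is what becomes a smaller
  -- branch later.
  record Separation (S P : Subset n) : Set where
    field
      P⊆S    : P ⊆ S
      inner  : ∃ λ x → x ∈ P
      outer  : ∃ λ z → z ∈ S × z ∉ P
      closed : ClosedIn S P

  Separation⇒¬Connected : ∀ {S P} → Separation S P → ¬ Connected G S
  Separation⇒¬Connected sep conn with Separation.inner sep | Separation.outer sep
  ... | x , x∈ | z , z∈ , z∉ = z∉ (Reach-closed (Separation.closed sep) (conn x z (Separation.P⊆S sep x∈) z∈) x∈)

  -- Both sides of a separation are closed, so the one without `w` can be chosen.
  Separation-avoid : ∀ {S P} → Separation S P → ∀ w → ∃ λ Q → Separation S Q × w ∉ Q
  Separation-avoid {S} {P} sep w with w ∈? P
  ... | no w∉ = P , sep , w∉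
  ... | yes w∈ = S ─ P , record
      { P⊆S = ─-∈
      ; inner = let (z , z∈ , z∉) = outer in z , x∈p∧x∉q⇒x∈p─q z∈ z∉
      ; outer = let (x , x∈) = inner in x , P⊆S x∈ , λ x∈′ → x∈p─q⇒x∉q x∈′ x∈
      ; closed = λ x∈ y∈ a → x∈p∧x∉q⇒x∈p─q y∈ λ y∈P → x∈p─q⇒x∉q x∈ (closed y∈P (─-∈ x∈) (~-sym a))
      } , λ w∈′ → x∈p─q⇒x∉q w∈′ w∈
    where open Separation sep

  connected? : ∀ S → Connected G S ⊎ ∃ (Separation S)
  connected? S with search {A = λ x → x ∈ S → ∀ y → y ∈ S → Reach G S x y} {B = λ _ → ∃ (Separation S)} try
    where
    try : ∀ x → (x ∈ S → ∀ y → y ∈ S → Reach G S x y) ⊎ ∃ (Separation S)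
    try x with x ∈? S
    ... | no x∉ = inj₁ λ x∈ → contradiction x∈ x∉
    ... | yes x∈ with component x∈
    ...   | c with any? (λ z → (z ∈? S) ×-dec ¬? (z ∈? Component.R c))
    ...     | yes out = inj₂ (R , record { P⊆S = R⊆S ; inner = x , x∈R ; outer = out ; closed = closed })
      where open Component c
    ...     | no ∄ = inj₁ λ _ y y∈ → reached y y∈ (y ∈? Component.R c)
      where
      reached : ∀ y → y ∈ S → Dec (y ∈ Component.R c) → Reach G S x y
      reached y y∈ (yes y∈R) = Component.reach c y∈R
      reached y y∈ (no y∉R) = contradiction (y , y∈ , y∉R) ∄
  ... | inj₁ conn = inj₁ λ x y x∈ y∈ → conn x x∈ y y∈
  ... | inj₂ (_ , sep) = inj₂ sep

  nonseparable? : ∀ S → Nonseparable G S ⊎ (∃ (Separation S) ⊎ ∃ λ w → w ∈ S × ∃ (Separation (S - w)))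
  nonseparable? S with connected? S
  ... | inj₂ sep = inj₂ (inj₁ sep)
  ... | inj₁ conn with search {A = λ w → w ∈ S → Connected G (S - w)}
                              {B = λ w → w ∈ S × ∃ (Separation (S - w))} try
    where
    try : ∀ w → (w ∈ S → Connected G (S - w)) ⊎ (w ∈ S × ∃ (Separation (S - w)))
    try w with w ∈? S
    ... | no w∉ = inj₁ λ w∈ → contradiction w∈ w∉
    ... | yes w∈ with connected? (S - w)
    ...   | inj₁ c = inj₁ λ _ → c
    ...   | inj₂ sep = inj₂ (w∈ , sep)
  ... | inj₁ cs = inj₁ (conn , cs)
  ... | inj₂ r = inj₂ (inj₂ r)

  Nonseparable? : ∀ S → Dec (Nonseparable G S)
  Nonseparable? S with nonseparable? S
  ... | inj₁ ns = yes ns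
  ... | inj₂ (inj₁ (_ , sep)) = no (Separation⇒¬Connected sep ∘ proj₁)
  ... | inj₂ (inj₂ (w , w∈ , _ , sep)) = no λ ns → Separation⇒¬Connected sep (proj₂ ns w w∈)

  _⊑?_ : ∀ (p q : Subset n) → Dec (∀ x → x ∈ p → x ∈ q)
  p ⊑? q = map′ (λ sub x → sub {x}) (λ sub {x} → sub x) (p ⊆? q)

  extendToBlock : ∀ {U T x} → x ∈ T → T ⊆ U → Nonseparable G T → ∃ λ B → IsBlock G U B × T ⊆ B
  extendToBlock {U} {T} {x} x∈ T⊆U nT = go T (⊃-wellFounded T) id T⊆U nT
    where
    go : ∀ B → Acc _⊃_ B → T ⊆ B → B ⊆ U → Nonseparable G B → ∃ λ B → IsBlock G U B × T ⊆ B
    go B (acc rs) T⊆B B⊆U nB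
      with anySubset? (λ B′ → (B ⊑? B′) ×-dec (B′ ⊑? U) ×-dec Nonseparable? B′
                            ×-dec any? (λ z → (z ∈? B′) ×-dec ¬? (z ∈? B)))
    ... | yes (B′ , B⊆B′ , B′⊆U , nB′ , z , z∈ , z∉) =
            go B′ (rs ((λ {x} → B⊆B′ x) , z , z∈ , z∉)) (B⊆B′ _ ∘ T⊆B) (B′⊆U _) nB′
    ... | no ∄ = B , (B⊆U , (x , T⊆B x∈) , nB , maximal) , T⊆B
      where
      maximal : ∀ B′ → B ⊆ B′ → B′ ⊆ U → Nonseparable G B′ → B′ ⊆ B
      maximal B′ B⊆ ⊆U nB′ {z} z∈ with z ∈? B
      ... | yes z∈B = z∈B
      ... | no z∉ = contradiction (B′ , (λ _ → B⊆) , (λ _ → ⊆U) , nB′ , z , z∈ , z∉) ∄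

  -- The union of the two blocks is nonseparable by `Nonseparable-∪`, so maximality makes each equal
  -- to it.
  block-unique : ∀ {U B B′ a b} → IsBlock G U B → IsBlock G U B′ → a ≢ b
               → a ∈ B → a ∈ B′ → b ∈ B → b ∈ B′ → B ≡ B′
  block-unique {U} {B} {B′} (B⊆ , _ , nB , mB) (B′⊆ , _ , nB′ , mB′) a≢b a∈ a∈′ b∈ b∈′ =
    ⊆-antisym (λ x∈ → mB′ _ ∪-right ∪⊆ n∪ (∪-left x∈)) (λ x∈ → mB _ ∪-left ∪⊆ n∪ (∪-right {B} x∈))
    where
    n∪ : Nonseparable G (B ∪ B′)
    n∪ = Nonseparable-∪ nB nB′ a≢b a∈ a∈′ b∈ b∈′
    ∪⊆ : B ∪ B′ ⊆ U
    ∪⊆ x∈ = [ B⊆ , B′⊆ ]′ (∪-cases x∈)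

  edge-block : ∀ {U x y} → x ∈ U → y ∈ U → x ~ y → ∃ λ B → IsBlock G U B × x ∈ B × y ∈ B
  edge-block {U} {x} {y} x∈ y∈ a
    with extendToBlock ∈-pairˡ (λ z∈ → [ (λ { refl → x∈ }) , (λ { refl → y∈ }) ]′ (pair-cases z∈)) (Nonseparable-edge a)
  ... | B , isB , sub = B , isB , sub ∈-pairˡ , sub ∈-pairʳ

  vertex-block : ∀ {U x} → x ∈ U → ∃ λ B → IsBlock G U B × x ∈ B
  vertex-block {U} {x} x∈ with extendToBlock (x∈⁅x⁆ x) (λ z∈ → subst (_∈ U) (sym (x∈⁅y⁆⇒x≡y x z∈)) x∈) (Nonseparable-⁅⁆ x)
  ... | B , isB , sub = B , isB , sub (x∈⁅x⁆ x)

  -- K is a union of components of G[U] - w.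
  record Branch (U : Subset n) (w : Fin n) (K : Subset n) : Set where
    field
      K⊆U    : K ⊆ U
      w∈U    : w ∈ U
      w∉K    : w ∉ K
      inner  : ∃ λ x → x ∈ K
      closed : ∀ {x y} → x ∈ K → y ∈ U → x ~ y → y ∈ K ⊎ y ≡ w

    hull : Subset n
    hull = K ∪ ⁅ w ⁆

    w∈hull : w ∈ hull
    w∈hull = ∪-right {K} (x∈⁅x⁆ w)

    K⊆hull : K ⊆ hull
    K⊆hull = ∪-left

    hull-cases : ∀ {x} → x ∈ hull → x ∈ K ⊎ x ≡ w
    hull-cases x∈ with ∪-cases {K} x∈
    ... | inj₁ x∈K = inj₁ x∈K
    ... | inj₂ x∈w = inj₂ (x∈⁅y⁆⇒x≡y w x∈w)

    hull-≢ : ∀ {x} → x ∈ hull → x ≢ w → x ∈ K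
    hull-≢ x∈ x≢ = [ id , (λ e → contradiction e x≢) ]′ (hull-cases x∈)

    hull⊆U : hull ⊆ U
    hull⊆U x∈ = [ K⊆U , (λ { refl → w∈U }) ]′ (hull-cases x∈)

    nbr-hull : ∀ {x y} → x ∈ K → y ∈ U → x ~ y → y ∈ hull
    nbr-hull x∈ y∈ a = [ K⊆hull , (λ { refl → w∈hull }) ]′ (closed x∈ y∈ a)

  -- An escape in the search for end-blocks: Staller has won at once on a graph with such a vertex.
  Isolated : Subset n → Fin n → Set
  Isolated U y = y ∈ U × (∀ z → y ~ z → z ∉ U)

  -- If x separates the hull of K, some side of the separation is a smaller branch at x.
  splitBranch : ∀ {U w K} (b : Branch U w K)
    → Nonseparable G (Branch.hull b) ⊎ (∃ (Isolated U)
      ⊎ ∃ λ w′ → ∃ λ K′ → Branch U w′ K′ × K′ ⊂ K × (w′ ≡ w ⊎ w′ ∈ K))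
  splitBranch {U} {w} {K} b with nonseparable? (Branch.hull b)
  ... | inj₁ ns = inj₁ ns
  ... | inj₂ (inj₁ (_ , sep₀)) = inj₂ (leaf (Separation-avoid sep₀ w))
    where
    open Branch b
    leaf : (∃ λ P → Separation hull P × w ∉ P) → ∃ (Isolated U)
         ⊎ ∃ λ w′ → ∃ λ K′ → Branch U w′ K′ × K′ ⊂ K × (w′ ≡ w ⊎ w′ ∈ K)
    -- `P` avoids `w`, so no edge of `G[U]` leaves it. Any `p` in `P` can then act as attaching
    -- vertex for the rest of `P`, unless `P` consists of the isolated vertex `p` alone.
    leaf (P , sep , w∉P) with Separation.inner sep
    ... | p , p∈ with nonempty? (P - p)
    ...   | no ∄ = inj₁ (p , K⊆U (P⊆K p∈) , λ z a z∈ →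
              ∄ (z , x∈p∧x≢y⇒x∈p-y (clP p∈ z∈ a) (~-≢ (~-sym a))))
      where
      P⊆K : P ⊆ K
      P⊆K x∈ = hull-≢ (Separation.P⊆S sep x∈) λ { refl → w∉P x∈ }
      clP : ∀ {x y} → x ∈ P → y ∈ U → x ~ y → y ∈ P
      clP x∈ y∈ a = Separation.closed sep x∈ (nbr-hull (P⊆K x∈) y∈ a) a
    ...   | yes ne = inj₂ (p , P - p , record
              { K⊆U = K⊆U ∘ P⊆K ∘ -∈ ; w∈U = K⊆U (P⊆K p∈) ; w∉K = λ p∈′ → -≢ p∈′ refl
              ; inner = ne ; closed = cl }
            , ((P⊆K ∘ -∈) , p , P⊆K p∈ , λ p∈′ → -≢ p∈′ refl) , inj₂ (P⊆K p∈))
      where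
      P⊆K : P ⊆ K
      P⊆K x∈ = hull-≢ (Separation.P⊆S sep x∈) λ { refl → w∉P x∈ }
      cl : ∀ {x y} → x ∈ P - p → y ∈ U → x ~ y → y ∈ P - p ⊎ y ≡ p
      cl {y = y} x∈ y∈ a with y ≟ p
      ... | yes e = inj₂ e
      ... | no y≢ = inj₁ (x∈p∧x≢y⇒x∈p-y
            (Separation.closed sep (-∈ x∈) (nbr-hull (P⊆K (-∈ x∈)) y∈ a) a) y≢)
  ... | inj₂ (inj₂ (x , x∈ , P₀ , sep₀)) with x ≟ w
  -- Here `K` itself is disconnected, and one side is a smaller branch at the same vertex `w`.
  ...   | yes refl = inj₂ (inj₂ (w , P₀ , record
          { K⊆U = K⊆U ∘ P⊆K ; w∈U = w∈U ; w∉K = w∉K ∘ P⊆K ; inner = Separation.inner sep₀ ; closed = cl }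
        , (P⊆K , out) , inj₁ refl))
    where
    open Branch b
    P⊆K : P₀ ⊆ K
    P⊆K x∈ = let h = Separation.P⊆S sep₀ x∈ in hull-≢ (-∈ h) (-≢ h)
    out : ∃ λ z → z ∈ K × z ∉ P₀
    out with Separation.outer sep₀
    ... | z , z∈ , z∉ = z , hull-≢ (-∈ z∈) (-≢ z∈) , z∉
    cl : ∀ {x y} → x ∈ P₀ → y ∈ U → x ~ y → y ∈ P₀ ⊎ y ≡ w
    cl {y = y} x∈ y∈ a with y ≟ w
    ... | yes e = inj₂ e
    ... | no y≢ = inj₁ (Separation.closed sep₀ x∈ (x∈p∧x≢y⇒x∈p-y (nbr-hull (P⊆K x∈) y∈ a) y≢) a)
  -- The side without `w` is attached at the cut vertex `x`, and it is smaller than `K` because `x`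
  -- lies in `K` but not in it.
  ...   | no x≢w with Separation-avoid sep₀ w
  ...     | P , sep , w∉P = inj₂ (inj₂ (x , P , record
          { K⊆U = K⊆U ∘ P⊆K ; w∈U = hull⊆U x∈ ; w∉K = λ x∈P → -≢ (Separation.P⊆S sep x∈P) refl
          ; inner = Separation.inner sep ; closed = cl }
        , (P⊆K , x , x∈K , λ x∈P → -≢ (Separation.P⊆S sep x∈P) refl) , inj₂ x∈K))
    where
    open Branch b
    x∈K : x ∈ K
    x∈K = hull-≢ x∈ x≢w
    P⊆K : P ⊆ K
    P⊆K z∈ = hull-≢ (-∈ (Separation.P⊆S sep z∈)) λ { refl → w∉P z∈ }
    cl : ∀ {z y} → z ∈ P → y ∈ U → z ~ y → y ∈ P ⊎ y ≡ x
    cl {y = y} z∈ y∈ a with y ≟ x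
    ... | yes e = inj₂ e
    ... | no y≢ = inj₁ (Separation.closed sep z∈ (x∈p∧x≢y⇒x∈p-y (nbr-hull (P⊆K z∈) y∈ a) y≢) a)

  record Leaf (U : Subset n) (w : Fin n) (K : Subset n) : Set where
    field
      branch : Branch U w K
      nonsep : Nonseparable G (Branch.hull branch)
    open Branch branch public

  -- Iterates `splitBranch`. The place of `w′` is recorded so that the hull of the leaf stays within
  -- the hull of `K`.
  leafIn : ∀ {U w K} → Branch U w K
         → ∃ (Isolated U) ⊎ ∃ λ w′ → ∃ λ K′ → Leaf U w′ K′ × K′ ⊆ K × (w′ ≡ w ⊎ w′ ∈ K)
  leafIn {K = K₀} = go (⊂-wellFounded K₀)
    where
    go : ∀ {U w K} → Acc _⊂_ K → Branch U w K
       → ∃ (Isolated U) ⊎ ∃ λ w′ → ∃ λ K′ → Leaf U w′ K′ × K′ ⊆ K × (w′ ≡ w ⊎ w′ ∈ K)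
    go (acc rs) b with splitBranch b
    ... | inj₁ ns = inj₂ (_ , _ , record { branch = b ; nonsep = ns } , id , inj₁ refl)
    ... | inj₂ (inj₁ iso) = inj₁ iso
    ... | inj₂ (inj₂ (w′ , K′ , b′ , K′⊂K , w′-in)) with go (rs K′⊂K) b′
    ...   | inj₁ iso = inj₁ iso
    ...   | inj₂ (w″ , K″ , l , K″⊆ , w″-in) = inj₂ (w″ , K″ , l , proj₁ K′⊂K ∘ K″⊆
            , [ (λ { refl → w′-in }) , inj₂ ∘ proj₁ K′⊂K ]′ w″-in)

  -- `T - w` is still connected, and a walk starting in `K` can leave `K` only through `w`.
  Branch-absorbs : ∀ {U w K T x} (b : Branch U w K) → T ⊆ U → Nonseparable G T → x ∈ T → x ∈ K
                 → T ⊆ Branch.hull b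
  Branch-absorbs {U} {w} {K} {T} {x} b T⊆U nT x∈T x∈K {z} z∈ with z ≟ w
  ... | yes refl = Branch.w∈hull b
  ... | no z≢ = K⊆hull (Reach-closed
        (λ a∈ b∈ e → [ id , (λ b≡w → contradiction b≡w (-≢ b∈)) ]′ (closed a∈ (T⊆U (-∈ b∈)) e))
        (Nonseparable-minus nT w x z (x∈p∧x≢y⇒x∈p-y x∈T λ { refl → w∉K x∈K })
          (x∈p∧x≢y⇒x∈p-y z∈ z≢)) x∈K)
    where open Branch b

  leaf-block : ∀ {U w K} (l : Leaf U w K) → IsBlock G U (Leaf.hull l)
  leaf-block {w = w} l = hull⊆U , (w , w∈hull) , nonsep , λ T h⊆T T⊆U nT →
      let (_ , x∈) = inner in Branch-absorbs branch T⊆U nT (h⊆T (K⊆hull x∈)) x∈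
    where open Leaf l

  leaf-endBlock : ∀ {U w K} (l : Leaf U w K) → IsEndBlock G U (Leaf.hull l)
  leaf-endBlock {U} {w} {K} l = leaf-block l , λ u v u∈ v∈ ou ov → trans (shared u∈ ou) (sym (shared v∈ ov))
    where
    open Leaf l
    shared : ∀ {u} → u ∈ hull → (∃ λ B → IsBlock G U B × B ≢ hull × u ∈ B) → u ≡ w
    shared {u} u∈ (B , (B⊆U , _ , nB , mB) , B≢ , u∈B) with u ≟ w
    ... | yes e = e
    ... | no u≢ = contradiction (⊆-antisym B⊆ (mB hull B⊆ hull⊆U nonsep)) B≢
      where
      B⊆ : B ⊆ hull
      B⊆ = Branch-absorbs branch B⊆U nB u∈B (hull-≢ u∈ u≢)

  componentBranch : ∀ {U v y} → v ∈ U → (c : Component (U - v) y) → Branch U v (Component.R c)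
  componentBranch {U} {v} {y} v∈ c = record
    { K⊆U = -∈ ∘ R⊆S ; w∈U = v∈ ; w∉K = λ v∈R → -≢ (R⊆S v∈R) refl ; inner = y , x∈R ; closed = cl }
    where
    open Component c
    cl : ∀ {x z} → x ∈ R → z ∈ U → x ~ z → z ∈ R ⊎ z ≡ v
    cl {z = z} x∈ z∈ a with z ≟ v
    ... | yes e = inj₂ e
    ... | no z≢ = inj₁ (closed x∈ (x∈p∧x≢y⇒x∈p-y z∈ z≢) a)

  -- If the component of `y` in `U - v` is not itself a leaf at `v`, a smaller branch splits off. It
  -- cannot be attached at `v` again, since it would then be a closed proper part of a connected
  -- set; so it is attached inside the component, away from `v`.
  componentLeaf : ∀ {U v y} (v∈ : v ∈ U) (c : Component (U - v) y)
    → Leaf U v (Component.R c) ⊎ (∃ (Isolated U) ⊎ ∃ λ w → ∃ λ K → Σ (Leaf U w K) λ l → v ∉ Leaf.hull l)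
  componentLeaf {U} {v} {y} v∈ c with splitBranch (componentBranch v∈ c)
  ... | inj₁ ns = inj₁ (record { branch = componentBranch v∈ c ; nonsep = ns })
  ... | inj₂ (inj₁ iso) = inj₂ (inj₁ iso)
  ... | inj₂ (inj₂ (w , K , b , (K⊆R , z , z∈R , z∉K) , inj₁ refl)) with Branch.inner b
  ...   | k , k∈ = contradiction (Reach-closed cl
            (Reach-trans (Reach-sym (reach (K⊆R k∈))) (reach z∈R)) k∈) z∉K
    where
    open Component c
    cl : ClosedIn (U - v) K
    cl x∈ y∈ a = [ id , (λ e → contradiction e (-≢ y∈)) ]′ (Branch.closed b x∈ (-∈ y∈) a)
  componentLeaf {U} {v} {y} v∈ c | inj₂ (inj₂ (w , K , b , (K⊆R , _) , inj₂ w∈R)) with leafIn b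
  ... | inj₁ iso = inj₂ (inj₁ iso)
  ... | inj₂ (w′ , K′ , l , K′⊆K , w′-in) = inj₂ (inj₂ (w′ , K′ , l , v∉))
    where
    v∉R : v ∉ Component.R c
    v∉R v∈R = -≢ (Component.R⊆S c v∈R) refl
    v∉ : v ∉ Leaf.hull l
    v∉ v∈h = [ v∉R ∘ K⊆R ∘ K′⊆K
             , (λ { refl → [ (λ { refl → v∉R w∈R }) , v∉R ∘ K⊆R ]′ w′-in }) ]′ (Leaf.hull-cases l v∈h)

  -- Cycles rooted at a vertex

  -- Renumbers a cycle from a chosen start `o`, with natural numbers modulo `k` as indices, so that
  -- the wrap-around cases of `CycAdj` are treated only here.
  module Rotation (m : ℕ) where
    k : ℕ
    k = ℕ.suc m

    rot : Fin k → ℕ → Fin k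
    rot o i = (i + toℕ o) mod k

    toℕ-rot : ∀ o i → toℕ (rot o i) ≡ (i + toℕ o) % k
    toℕ-rot o i = toℕ-fromℕ< (m%n<n (i + toℕ o) k)

    suc-% : ∀ a → ℕ.suc a % k ≡ ℕ.suc (a % k) % k
    suc-% a = trans (cong (λ b → ℕ.suc b % k) (m≡m%n+[m/n]*n a k)) ([m+kn]%n≡m%n (ℕ.suc (a % k)) (a / k) k)

    suc-%-cases : ∀ a → ℕ.suc a % k ≡ ℕ.suc (a % k) ⊎ (ℕ.suc (a % k) ≡ k × ℕ.suc a % k ≡ 0)
    suc-%-cases a with ℕ.m≤n⇒m<n∨m≡n (m%n<n a k)
    ... | inj₁ lt = inj₁ (trans (suc-% a) (m<n⇒m%n≡m lt))
    ... | inj₂ e = inj₂ (e , trans (suc-% a) (trans (cong (_% k) e) (n%n≡0 k)))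

    +-% : ∀ a b → (a + b % k) % k ≡ (a + b) % k
    +-% a b = begin
      (a + b % k) % k             ≡⟨ %-distribˡ-+ a (b % k) k ⟩
      (a % k + b % k % k) % k     ≡⟨ cong (λ c → (a % k + c) % k) (m%n%n≡m%n b k) ⟩
      (a % k + b % k) % k         ≡⟨ %-distribˡ-+ a b k ⟨
      (a + b) % k                 ∎
      where open ≡-Reasoning

    complement : ∀ (o : Fin k) → (k ∸ toℕ o) + toℕ o ≡ k
    complement o = ℕ.m∸n+n≡m (ℕ.<⇒≤ (toℕ<n o))

    rot-per : ∀ o i → rot o (k + i) ≡ rot o i
    rot-per o i = toℕ-injective (begin
      toℕ (rot o (k + i))     ≡⟨ toℕ-rot o (k + i) ⟩
      (k + i + toℕ o) % k     ≡⟨ cong (_% k) (trans (ℕ.+-assoc k i (toℕ o)) (ℕ.+-comm k (i + toℕ o))) ⟩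
      (i + toℕ o + k) % k     ≡⟨ [m+n]%n≡m%n (i + toℕ o) k ⟩
      (i + toℕ o) % k         ≡⟨ toℕ-rot o i ⟨
      toℕ (rot o i)           ∎)
      where open ≡-Reasoning

    rot-0 : ∀ o → rot o 0 ≡ o
    rot-0 o = toℕ-injective (trans (toℕ-rot o 0) (m<n⇒m%n≡m (toℕ<n o)))

    rot-cover : ∀ o j → ∃ λ i → i < k × rot o i ≡ j
    rot-cover o j = (toℕ j + (k ∸ toℕ o)) % k , m%n<n (toℕ j + (k ∸ toℕ o)) k , toℕ-injective (begin
      toℕ (rot o (b % k))                  ≡⟨ toℕ-rot o (b % k) ⟩
      (b % k + toℕ o) % k                  ≡⟨ cong (_% k) (ℕ.+-comm (b % k) (toℕ o)) ⟩
      (toℕ o + b % k) % k                  ≡⟨ +-% (toℕ o) b ⟩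
      (toℕ o + b) % k                      ≡⟨ cong (_% k) (ℕ.+-comm (toℕ o) b) ⟩
      (toℕ j + (k ∸ toℕ o) + toℕ o) % k    ≡⟨ cong (_% k) (trans (ℕ.+-assoc (toℕ j) _ _) (cong (toℕ j +_) (complement o))) ⟩
      (toℕ j + k) % k                      ≡⟨ [m+n]%n≡m%n (toℕ j) k ⟩
      toℕ j % k                            ≡⟨ m<n⇒m%n≡m (toℕ<n j) ⟩
      toℕ j                                ∎)
      where
      open ≡-Reasoning
      b = toℕ j + (k ∸ toℕ o)

    rot-inj : ∀ o {i j} → i < k → j < k → rot o i ≡ rot o j → i ≡ j
    rot-inj o {i} {j} i< j< e = trans (sym (undo i i<)) (trans (cong (λ r → ((k ∸ toℕ o) + r) % k) same) (undo j j<))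
      where
      open ≡-Reasoning
      same : (i + toℕ o) % k ≡ (j + toℕ o) % k
      same = trans (sym (toℕ-rot o i)) (trans (cong toℕ e) (toℕ-rot o j))
      undo : ∀ i → i < k → ((k ∸ toℕ o) + (i + toℕ o) % k) % k ≡ i
      undo i i< = begin
        ((k ∸ toℕ o) + (i + toℕ o) % k) % k   ≡⟨ +-% (k ∸ toℕ o) (i + toℕ o) ⟩
        ((k ∸ toℕ o) + (i + toℕ o)) % k       ≡⟨ cong (_% k) (ℕ.+-comm (k ∸ toℕ o) (i + toℕ o)) ⟩
        (i + toℕ o + (k ∸ toℕ o)) % k         ≡⟨ cong (_% k) (trans (ℕ.+-assoc i _ _) (cong (i +_) (trans (ℕ.+-comm (toℕ o) _) (complement o)))) ⟩
        (i + k) % k                           ≡⟨ [m+n]%n≡m%n i k ⟩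
        i % k                                 ≡⟨ m<n⇒m%n≡m i< ⟩
        i                                     ∎

    rot-adj : ∀ o i → CycAdj k (rot o i) (rot o (ℕ.suc i))
    rot-adj o i rewrite toℕ-rot o i | toℕ-rot o (ℕ.suc i) with suc-%-cases (i + toℕ o)
    ... | inj₁ e = inj₁ e
    ... | inj₂ (e , z) = inj₂ (inj₂ (inj₂ (z , e)))

    rot-nbr : ∀ o i j → CycAdj k (rot o (ℕ.suc i)) j → j ≡ rot o i ⊎ j ≡ rot o (2 + i)
    rot-nbr o i j adj rewrite toℕ-rot o (ℕ.suc i) = cases adj
      where
      a = i + toℕ o
      isˡ : toℕ j ≡ a % k → j ≡ rot o i
      isˡ e = toℕ-injective (trans e (sym (toℕ-rot o i)))
      isʳ : toℕ j ≡ (2 + a) % k → j ≡ rot o (2 + i)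
      isʳ e = toℕ-injective (trans e (sym (toℕ-rot o (2 + i))))
      cases : (toℕ j ≡ ℕ.suc (ℕ.suc a % k)) ⊎ (ℕ.suc a % k ≡ ℕ.suc (toℕ j))
            ⊎ ((ℕ.suc a % k ≡ 0 × ℕ.suc (toℕ j) ≡ k) ⊎ (toℕ j ≡ 0 × ℕ.suc (ℕ.suc a % k) ≡ k))
            → j ≡ rot o i ⊎ j ≡ rot o (2 + i)
      cases (inj₁ e) with suc-%-cases (ℕ.suc a)
      ... | inj₁ e′ = inj₂ (isʳ (trans e (sym e′)))
      ... | inj₂ (e′ , _) = contradiction (toℕ<n j) (ℕ.<-irrefl (trans e e′))
      cases (inj₂ (inj₁ e)) with suc-%-cases a
      ... | inj₁ e′ = inj₁ (isˡ (ℕ.suc-injective (trans (sym e) e′)))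
      ... | inj₂ (_ , z) = contradiction (trans (sym z) e) λ ()
      cases (inj₂ (inj₂ (inj₁ (z , e)))) with suc-%-cases a
      ... | inj₁ e′ = contradiction (trans (sym z) e′) λ ()
      ... | inj₂ (e′ , _) = inj₁ (isˡ (ℕ.suc-injective (trans e (sym e′))))
      cases (inj₂ (inj₂ (inj₂ (z , e)))) with suc-%-cases (ℕ.suc a)
      ... | inj₁ e′ = contradiction (m%n<n (2 + a) k) (ℕ.<-irrefl (trans e′ e))
      ... | inj₂ (_ , z′) = inj₂ (isʳ (trans z (sym z′)))

  -- A spanning cycle of `S`, chords allowed, started at `w` and continued periodically over the
  -- natural numbers.
  record Loop (k : ℕ) (S : Subset n) (w : Fin n) : Set where
    field
      g     : ℕ → Fin n
      root  : g 0 ≡ w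
      g-∈   : ∀ i → g i ∈ S
      per   : ∀ i → g (k + i) ≡ g i
      cover : ∀ {x} → x ∈ S → ∃ λ i → i < k × g i ≡ x
      adj   : ∀ i → g i ~ g (ℕ.suc i)
      inj   : ∀ {i j} → i < k → j < k → g i ≡ g j → i ≡ j

  -- `nbr` speaks of index `suc i`, which gives both neighbours indices without a predecessor. The
  -- root is reached as `g k`.
  record InducedLoop (k : ℕ) (S : Subset n) (w : Fin n) : Set where
    field
      loop : Loop k S w
    open Loop loop public
    field
      nbr : ∀ i {y} → y ∈ S → g (ℕ.suc i) ~ y → y ≡ g i ⊎ y ≡ g (2 + i)

  mkLoop : ∀ {k S w} (c : Fin k → Fin n) → Injective _≡_ _≡_ c
         → (∀ {x} → x ∈ S → ∃ λ i → c i ≡ x) → (∀ i → c i ∈ S)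
         → (∀ i j → CycAdj k i j → c i ~ c j) → (o : Fin k) → c o ≡ w → Loop k S w
  mkLoop {ℕ.suc m} c c-inj cov c-∈ c-adj o e = record
    { g = c ∘ rot o
    ; root = trans (cong c (rot-0 o)) e
    ; g-∈ = λ _ → c-∈ _
    ; per = λ i → cong c (rot-per o i)
    ; cover = cover
    ; adj = λ i → c-adj _ _ (rot-adj o i)
    ; inj = λ i< j< e → rot-inj o i< j< (c-inj e)
    }
    where
    open Rotation m
    cover : ∀ {x} → x ∈ _ → ∃ λ i → i < ℕ.suc m × c (rot o i) ≡ x
    cover x∈ with cov x∈
    ... | j , e₁ with rot-cover o j
    ...   | i , i< , e′ = i , i< , trans (cong c e′) e₁

  abstract
    rootAt : ∀ {k S w} → InducesCycle G k S → w ∈ S → InducedLoop k S w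
    rootAt {k} {S} {w} (c , c-inj , c-S , c-adj) w∈ with to (c-S w) w∈
    rootAt {ℕ.suc m} {S} {w} (c , c-inj , c-S , c-adj) w∈ | o , e = record
      { loop = mkLoop c c-inj (λ {x} → to (c-S x)) (λ i → from (c-S _) (i , refl)) (λ i j → from (c-adj i j)) o e
      ; nbr = nbr
      }
      where
      open Rotation m
      nbr : ∀ i {y} → y ∈ S → c (rot o (ℕ.suc i)) ~ y → y ≡ c (rot o i) ⊎ y ≡ c (rot o (2 + i))
      nbr i {y} y∈ a with to (c-S y) y∈
      ... | j , refl with rot-nbr o i j (to (c-adj _ _) a)
      ...   | inj₁ e = inj₁ (cong c e)
      ...   | inj₂ e = inj₂ (cong c e)

  InducesCycle⇒HasCycle : ∀ {k S U} → 3 ≤ k → S ⊆ U → InducesCycle G k S → HasCycle G U k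
  InducesCycle⇒HasCycle 3≤k S⊆U (c , c-inj , c-S , c-adj) =
    3≤k , c , c-inj , (λ i → S⊆U (from (c-S _) (i , refl))) , λ i j → from (c-adj i j)

  module _ {k : ℕ} (c : Fin k → Fin n) where
    abstract
      image : Subset n
      image = Vec.tabulate λ x → does (any? λ i → c i ≟ x)

      ∈-image : ∀ i → c i ∈ image
      ∈-image i = ∈-tabulate (dec-true (any? λ j → c j ≟ c i) (i , refl))

      ∈-image⁻ : ∀ {x} → x ∈ image → ∃ λ i → c i ≡ x
      ∈-image⁻ {x} x∈ with any? (λ i → c i ≟ x) | ∈-tabulate⁻ {f = λ x → does (any? λ i → c i ≟ x)} x∈
      ... | yes r | _ = r

  -- Rooting the cycle at the deleted vertex leaves the path `g 1`, `g 2`, ..., which is why a loop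
  -- is required at every vertex of `S`.
  Nonseparable-loop : ∀ {k S} → (∀ {w} → w ∈ S → Loop k S w) → Nonseparable G S
  Nonseparable-loop {k} {S} rooted = conn , minus
    where
    conn : Connected G S
    conn x y x∈ y∈ with rooted x∈
    ... | L = subst (λ z → Reach G S z y) root (from₀ (cover y∈))
      where
      open Loop L
      walk : ∀ i → Reach G S (g 0) (g i)
      walk 0 = here (g-∈ 0)
      walk (ℕ.suc i) = Reach-snoc (walk i) (adj i) (g-∈ _)
      from₀ : (∃ λ i → i < k × g i ≡ y) → Reach G S (g 0) y
      from₀ (i , _ , refl) = walk i
    minus : ∀ w → w ∈ S → Connected G (S - w)
    minus w w∈ x y x∈ y∈ = Reach-trans (Reach-sym (from₁ x∈)) (from₁ y∈)
      where
      open Loop (rooted w∈)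
      present : ∀ i → ℕ.suc i < k → g (ℕ.suc i) ∈ S - w
      present i i< = x∈p∧x≢y⇒x∈p-y (g-∈ _) λ e →
        contradiction (inj i< (ℕ.≤-<-trans z≤n i<) (trans e (sym root))) λ ()
      walk : ∀ i → ℕ.suc i < k → Reach G (S - w) (g 1) (g (ℕ.suc i))
      walk 0 i< = here (present 0 i<)
      walk (ℕ.suc i) i< = Reach-snoc (walk i (ℕ.<⇒≤ i<)) (adj _) (present _ i<)
      from₁ : ∀ {x} → x ∈ S - w → Reach G (S - w) (g 1) x
      from₁ x∈ with cover (-∈ x∈)
      ... | 0 , _ , refl = contradiction root (-≢ x∈)
      ... | ℕ.suc i , i< , refl = walk i i<

  Nonseparable-image : ∀ {k} (c : Fin k → Fin n) → Injective _≡_ _≡_ c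
                     → (∀ i j → CycAdj k i j → c i ~ c j) → Nonseparable G (image c)
  Nonseparable-image c c-inj c-adj = Nonseparable-loop λ w∈ → let (o , e) = ∈-image⁻ c w∈ in
    mkLoop c c-inj (∈-image⁻ c) (∈-image c) c-adj o e

  preimages-≤ : ∀ {k j} (c : Fin k → Fin n) (d : Fin j → Fin n) → Injective _≡_ _≡_ c
              → (∀ i → ∃ λ l → d l ≡ c i) → k ≤ j
  preimages-≤ c d c-inj pre = injective⇒≤ {f = λ i → proj₁ (pre i)} λ {i} {j} e →
    c-inj (trans (sym (proj₂ (pre i))) (trans (cong d e) (proj₂ (pre j))))

  cycleSize-≤ : ∀ {k j S T} → S ⊆ T → (c : Fin k → Fin n) → Injective _≡_ _≡_ c → (∀ i → c i ∈ S)
              → InducesCycle G j T → k ≤ j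
  cycleSize-≤ S⊆T c c-inj c-∈ (d , _ , d-T , _) = preimages-≤ c d c-inj λ i → to (d-T (c i)) (S⊆T (c-∈ i))

  ThreeIn : Subset n → Set
  ThreeIn T = ∃ λ a → ∃ λ b → ∃ λ c → (a ∈ T × b ∈ T × c ∈ T) × (a ≢ b × a ≢ c × b ≢ c)

  -- One neighbour `p` comes from connectedness of `T`, a second one from connectedness of `T - p`;
  -- the third vertex ensures that `x` is not alone in `T - p`.
  two-nbrs : ∀ {T x} → Nonseparable G T → ThreeIn T → x ∈ T
           → ∃ λ p → ∃ λ q → (p ∈ T × q ∈ T) × p ≢ q × (x ~ p × x ~ q)
  two-nbrs {T} {x} nT (a , b , c , (a∈ , b∈ , c∈) , (a≢b , a≢c , b≢c)) x∈ = first (avoid x x)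
    where
    avoid : ∀ y z → ∃ λ u → u ∈ T × u ≢ y × u ≢ z
    avoid y z with a ≟ y | a ≟ z
    ... | no p | no q = a , a∈ , p , q
    avoid y z | yes refl | _ with b ≟ z
    ... | no q = b , b∈ , (a≢b ∘ sym) , q
    ... | yes refl = c , c∈ , (a≢c ∘ sym) , (b≢c ∘ sym)
    avoid y z | no _ | yes refl with b ≟ y
    ... | no q = b , b∈ , q , (a≢b ∘ sym)
    ... | yes refl = c , c∈ , (b≢c ∘ sym) , (a≢c ∘ sym)

    first : (∃ λ u → u ∈ T × u ≢ x × u ≢ x)
          → ∃ λ p → ∃ λ q → (p ∈ T × q ∈ T) × p ≢ q × (x ~ p × x ~ q)
    first (u , u∈ , u≢x , _) with Reach-first (proj₁ nT x u x∈ u∈) (u≢x ∘ sym)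
    ... | p , p∈ , x~p with avoid x p
    ...   | v , v∈ , v≢x , v≢p with Reach-first (Nonseparable-minus nT p x v
              (x∈p∧x≢y⇒x∈p-y x∈ (~-≢ x~p)) (x∈p∧x≢y⇒x∈p-y v∈ v≢p)) (v≢x ∘ sym)
    ...     | q , q∈ , x~q = p , q , (p∈ , -∈ q∈) , (-≢ q∈ ∘ sym) , (x~p , x~q)

  -- A vertex of `T` has two neighbours in `T`, and on an induced cycle these are both its
  -- neighbours in `B`. So `T` contains the next vertex each time, and hence the whole cycle.
  cycle-minimal : ∀ {k T B} → Nonseparable G T → ThreeIn T → T ⊆ B → InducesCycle G k B → B ⊆ T
  cycle-minimal {k} {T} {B} nT three@(a , _ , _ , (a∈ , _) , _) T⊆B ic {x} x∈ = found (cover x∈)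
    where
    L = rootAt ic (T⊆B a∈)
    open InducedLoop L
    next : ∀ i → g (ℕ.suc i) ∈ T → g (2 + i) ∈ T
    next i gi∈ with two-nbrs nT three gi∈
    ... | p , q , (p∈ , q∈) , p≢q , (a₁ , a₂) with nbr i (T⊆B p∈) a₁ | nbr i (T⊆B q∈) a₂
    ...   | inj₂ refl | _ = p∈
    ...   | inj₁ _ | inj₂ refl = q∈
    ...   | inj₁ e | inj₁ e′ = contradiction (trans e (sym e′)) p≢q
    -- The walk starts at `g k`, which is `g 0`, because `next` needs an index of the form `suc j`.
    all : ∀ i → g (i + k) ∈ T
    all 0 = subst (_∈ T) (sym (trans (cong g (sym (ℕ.+-identityʳ k))) (trans (per 0) root))) a∈
    all (ℕ.suc i) with i + k in eq | all i
    ... | ℕ.suc j | gi∈ = next j gi∈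
    ... | 0 | _ with cover x∈
    ...   | _ , i< , _ = contradiction (subst (_ <_) (ℕ.m+n≡0⇒n≡0 i eq) i<) λ ()
    found : (∃ λ i → i < k × g i ≡ x) → x ∈ T
    found (i , _ , refl) = subst (_∈ T) (trans (cong g (ℕ.+-comm i k)) (per i)) (all i)

  data Shape (T : Subset n) : Set where
    point : ∀ x → x ∈ T → (∀ {y} → y ∈ T → y ≡ x) → Shape T
    edge  : IsK2 G T → Shape T
    cycle : ∀ {k} → 3 ≤ k → InducesCycle G k T → Shape T

  InducesCycle-cong : ∀ {k S T} → S ⊆ T → T ⊆ S → InducesCycle G k S → InducesCycle G k T
  InducesCycle-cong S⊆ T⊆ (c , c-inj , c-S , c-adj) =
    c , c-inj , (λ x → mk⇔ (to (c-S x) ∘ T⊆) (S⊆ ∘ from (c-S x))) , c-adj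

  -- A nonseparable set with three vertices lies in a cycle block of `G` and fills it by
  -- `cycle-minimal`. So blocks of any `G[U]` are understood without any structure on `U`.
  shape : Cactus G ⊤ → ∀ {T x} → x ∈ T → Nonseparable G T → Shape T
  shape (_ , blocks) {T} {x} x∈ nT with any? (λ y → (y ∈? T) ×-dec ¬? (y ≟ x))
  ... | no ∄ = point x x∈ λ {y} y∈ → same y y∈ (y ≟ x)
    where
    same : ∀ y → y ∈ T → Dec (y ≡ x) → y ≡ x
    same y y∈ (yes e) = e
    same y y∈ (no y≢) = contradiction (y , y∈ , y≢) ∄
  ... | yes (y , y∈ , y≢x) with any? (λ z → (z ∈? T) ×-dec ¬? (z ≟ x) ×-dec ¬? (z ≟ y))
  ...   | no ∄ = edge (x , y , (y≢x ∘ sym) , x~y , λ z → mk⇔ (two z) λ { (inj₁ refl) → x∈ ; (inj₂ refl) → y∈ })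
    where
    two : ∀ z → z ∈ T → z ≡ x ⊎ z ≡ y
    two z z∈ with z ≟ x | z ≟ y
    ... | yes e | _ = inj₁ e
    ... | no _ | yes e = inj₂ e
    ... | no z≢x | no z≢y = contradiction (z , z∈ , z≢x , z≢y) ∄
    x~y : x ~ y
    x~y with Reach-first (proj₁ nT x y x∈ y∈) (y≢x ∘ sym)
    ... | z , z∈ , a with two z z∈
    ...   | inj₁ refl = contradiction refl (~-≢ a)
    ...   | inj₂ refl = a
  ...   | yes (z , z∈ , z≢x , z≢y) with extendToBlock x∈ (λ _ → ∈⊤) nT
  ...     | B , isB , T⊆B with blocks B isB
  ...       | inj₁ (k , 3≤k , ic) = cycle 3≤k (InducesCycle-cong
                (cycle-minimal nT (x , y , z , (x∈ , y∈ , z∈) , ((y≢x ∘ sym) , (z≢x ∘ sym) , (z≢y ∘ sym))) T⊆B ic)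
                T⊆B ic)
  ...       | inj₂ (u , v , _ , _ , uv) = ⊥-elim (clash (to (uv x) (T⊆B x∈)) (to (uv y) (T⊆B y∈)) (to (uv z) (T⊆B z∈)))
    where
    clash : x ≡ u ⊎ x ≡ v → y ≡ u ⊎ y ≡ v → z ≡ u ⊎ z ≡ v → ⊥
    clash (inj₁ refl) (inj₁ refl) _ = y≢x refl
    clash (inj₁ refl) (inj₂ refl) (inj₁ refl) = z≢x refl
    clash (inj₁ refl) (inj₂ refl) (inj₂ refl) = z≢y refl
    clash (inj₂ refl) (inj₁ refl) (inj₁ refl) = z≢y refl
    clash (inj₂ refl) (inj₁ refl) (inj₂ refl) = z≢x refl
    clash (inj₂ refl) (inj₂ refl) _ = y≢x refl

  -- Staller's play on end-blocks

  lt : ∀ {i k} {_ : True (i ℕ.<? k)} → i < k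
  lt {_} {_} {p} = toWitness p

  module LoopFacts {k : ℕ} {S : Subset n} {w : Fin n} (L : InducedLoop k S w) where
    open InducedLoop L public

    wrap : g k ≡ g 0
    wrap = trans (cong g (sym (ℕ.+-identityʳ k))) (per 0)

    distinct : ∀ i j → i < k → j < k → i ≢ j → g i ≢ g j
    distinct _ _ i< j< i≢j e = i≢j (inj i< j< e)

    ≢root : ∀ i → ℕ.suc i < k → g (ℕ.suc i) ≢ w
    ≢root i i< e = contradiction (inj i< (ℕ.≤-<-trans z≤n i<) (trans e (sym root))) λ ()

    far : ∀ i → 3 + i < k → ¬ g (2 + i) ~ w
    far i i< a with nbr (1 + i) (subst (_∈ S) root (g-∈ 0)) a
    ... | inj₁ e = ≢root i (ℕ.<-trans (ℕ.n<1+n _) (ℕ.<-trans (ℕ.n<1+n _) i<)) (sym e)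
    ... | inj₂ e = ≢root (2 + i) i< (sym e)

    rootNbr : ∀ {j y} → k ≡ ℕ.suc j → y ∈ S → w ~ y → y ≡ g 1 ⊎ y ≡ g j
    rootNbr {j} refl y∈ a with nbr j y∈ (subst (_~ _) (sym (trans wrap root)) a)
    ... | inj₁ e = inj₂ e
    ... | inj₂ e = inj₁ (trans e (trans (cong (g ∘ ℕ.suc) (ℕ.+-comm 1 j)) (per 1)))

  -- `B` meets the rest of `G[U]` only at `w`. This is the common feature of leaf hulls, of
  -- end-blocks as defined in the theorem, and of the blocks of a star cactus at its centre.
  record Lobe (U : Subset n) (w : Fin n) (B : Subset n) : Set where
    field
      B⊆U    : B ⊆ U
      w∈B    : w ∈ B
      closed : ∀ {x y} → x ∈ B → x ≢ w → y ∈ U → x ~ y → y ∈ B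

  leaf-lobe : ∀ {U w K} (l : Leaf U w K) → Lobe U w (Leaf.hull l)
  leaf-lobe l = record
    { B⊆U = hull⊆U ; w∈B = w∈hull ; closed = λ x∈ x≢w y∈ a → nbr-hull (hull-≢ x∈ x≢w) y∈ a }
    where open Leaf l

  NbrsIn-⊆ : ∀ {F U x u t} → F ⊆ U → NbrsIn U x u t → NbrsIn F x u t
  NbrsIn-⊆ sub h a y∈ = h a (sub y∈)

  module LobeFacts {U : Subset n} {w : Fin n} {B : Subset n} {k : ℕ} (lobe : Lobe U w B) (L : InducedLoop k B w) where
    open Lobe lobe public
    open LoopFacts L public

    nbrs : ∀ i → ℕ.suc i < k → NbrsIn U (g (ℕ.suc i)) (g i) (g (2 + i))
    nbrs i i< a y∈ = nbr i (closed (g-∈ _) (≢root i i<) y∈ a) a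

  -- With `w = g 0`, Staller plays `g 0`, forcing `g 2` because of `g 1`, then `g 1`, forcing `g 3`
  -- because of `g 2`. Dominator's two vertices have no neighbours outside `C`, so he gains nothing
  -- there, and Staller is on move again.
  removeC4-S : ∀ {U w C F A} → Lobe U w C → InducesCycle G 4 C → F ⊆ U → A ⊆ U
             → (∀ {x} → x ∈ C → x ≢ w → x ∈ A)
             → SW (F ─ C) (A ─ C) S-turn → SW F A S-turn
  removeC4-S {U} {w} {C} {F} {A} lobe ic F⊆U A⊆U C⊆A s =
    threat₂ {u = g 0} {t = g 2} (C⊆A (g-∈ 1) (≢root 0 lt)) (NbrsIn-⊆ F⊆U (nbrs 0 lt))
    (threat₂ {u = g 1} {t = g 3} (∈─N (C⊆A (g-∈ 2) (≢root 1 lt)) λ a → ~-≢ a refl)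
      (NbrsIn-⊆ (F⊆U ∘ -∈ ∘ -∈) (nbrs 1 lt))
    (SW-mono s S≼S
      (λ x∈ → ∈─N (∈─N (─-∈ x∈) (outside x∈ 2 lt lt)) (outside x∈ 3 lt lt))
      λ _ _ y∈ → x∈p∧x∉q⇒x∈p─q (-∈ (-∈ (-∈ (-∈ y∈)))) (used y∈)))
    where
    open LobeFacts lobe (rootAt ic (Lobe.w∈B lobe))
    outside : ∀ {x} → x ∈ A ─ C → ∀ i → 0 < i → i < 4 → ¬ x ~ g i
    outside x∈ (ℕ.suc i) _ i< a = x∈p─q⇒x∉q x∈ (closed (g-∈ (ℕ.suc i)) (≢root i i<) (A⊆U (─-∈ x∈)) (~-sym a))
    used : ∀ {y} → y ∈ F - g 0 - g 2 - g 1 - g 3 → y ∉ C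
    used y∈ y∈C with cover y∈C
    ... | 0 , _ , e = -≢ (-∈ (-∈ (-∈ y∈))) (sym e)
    ... | 1 , _ , e = -≢ (-∈ y∈) (sym e)
    ... | 2 , _ , e = -≢ (-∈ (-∈ y∈)) (sym e)
    ... | 3 , _ , e = -≢ y∈ (sym e)
    ... | ℕ.suc (ℕ.suc (ℕ.suc (ℕ.suc _))) , s≤s (s≤s (s≤s (s≤s ()))) , _

  -- The vertices of the hull other than `w` are not dominated by `v`. On a `K₂` Staller takes `w`.
  -- On a cycle of length `k` the two neighbours of `w` give a double threat, answered at `g 2` and
  -- `g (k - 2)`; these coincide exactly for `k = 4`.
  leaf-avoided : ∀ {U w K v} (l : Leaf U w K) → Shape (Leaf.hull l) → v ∈ U → v ∉ Leaf.hull l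
               → SW (U - v) (U ─ N v) S-turn ⊎ InducesCycle G 4 (Leaf.hull l)
  leaf-avoided {U} {w} {K} {v} l sh v∈ v∉ = by sh
    where
    open Leaf l using (hull; w∈hull; K⊆hull; K⊆U; inner; w∉K; hull-cases)
    lobe = leaf-lobe l
    alive : ∀ {x} → x ∈ hull → x ≢ w → x ∈ U ─ N v
    alive x∈ x≢ = ∈─N (Lobe.B⊆U lobe x∈) λ a → v∉ (Lobe.closed lobe x∈ x≢ v∈ a)
    by : Shape hull → SW (U - v) (U ─ N v) S-turn ⊎ InducesCycle G 4 hull
    by (point x x∈ only) with inner
    ... | y , y∈ = contradiction (subst (_∈ K) (trans (only (K⊆hull y∈)) (sym (only w∈hull))) y∈) w∉K
    by (edge (p , q , _ , _ , pq)) with inner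
    ... | y , y∈ = inj₁ (threat₁ {t = w} (alive (K⊆hull y∈) y≢w)
            λ {z} a z∈ → third (to (pq y) (K⊆hull y∈)) (to (pq w) w∈hull)
              (to (pq z) (Lobe.closed lobe (K⊆hull y∈) y≢w (-∈ z∈) a)) (~-≢ a))
      where
      y≢w : y ≢ w
      y≢w refl = w∉K y∈
      third : ∀ {z} → y ≡ p ⊎ y ≡ q → w ≡ p ⊎ w ≡ q → z ≡ p ⊎ z ≡ q → y ≢ z → z ≡ w
      third (inj₁ refl) _ (inj₁ refl) y≢z = contradiction refl y≢z
      third (inj₂ refl) _ (inj₂ refl) y≢z = contradiction refl y≢z
      third (inj₁ refl) (inj₁ refl) _ _ = contradiction refl y≢w
      third (inj₂ refl) (inj₂ refl) _ _ = contradiction refl y≢w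
      third (inj₁ refl) (inj₂ refl) (inj₂ refl) _ = refl
      third (inj₂ refl) (inj₁ refl) (inj₁ refl) _ = refl
    by (cycle {k} 3≤k ic) with k ℕ.≟ 4
    ... | yes refl = inj₂ ic
    by (cycle {ℕ.suc (ℕ.suc (ℕ.suc j))} (s≤s (s≤s (s≤s _))) ic) | no k≢4 = inj₁
      (doubleThreat {u = g 0} {t = g 2} {t′ = g (1 + j)} (alive (g-∈ 1) (≢root 0 1<k)) (alive (g-∈ (2 + j)) (≢root (1 + j) ℕ.≤-refl))
        (NbrsIn-⊆ -∈ (nbrs 0 1<k)) last
        (distinct _ _ 2<k (ℕ.m≤n⇒m≤1+n ℕ.≤-refl) λ e → k≢4 (cong (2 +_) (sym e))))
      where
      open LobeFacts lobe (rootAt ic w∈hull)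
      1<k : 1 < 3 + j
      1<k = s≤s (s≤s z≤n)
      2<k : 2 < 3 + j
      2<k = s≤s (s≤s (s≤s z≤n))
      last : NbrsIn (U - v) (g (2 + j)) (g 0) (g (1 + j))
      last a y∈ with nbrs (1 + j) ℕ.≤-refl a (-∈ y∈)
      ... | inj₁ e = inj₂ e
      ... | inj₂ e = inj₁ (trans e wrap)

  data SmallShape (T : Subset n) : Set where
    k₂ : IsK2 G T → SmallShape T
    c₃ : InducesCycle G 3 T → SmallShape T
    c₄ : InducesCycle G 4 T → SmallShape T
    c₅ : InducesCycle G 5 T → SmallShape T

  leaf-centred : ∀ {U v K} (l : Leaf U v K) → Shape (Leaf.hull l)
               → ¬ SW (U - v) (U ─ N v) S-turn → SmallShape (Leaf.hull l)
  leaf-centred {U} {v} {K} l sh ns = by sh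
    where
    open Leaf l using (hull; w∈hull; K⊆hull; inner; w∉K)
    by : Shape hull → SmallShape hull
    by (point x x∈ only) with inner
    ... | y , y∈ = contradiction (subst (_∈ K) (trans (only (K⊆hull y∈)) (sym (only w∈hull))) y∈) w∉K
    by (edge e) = k₂ e
    by (cycle {3} _ ic) = c₃ ic
    by (cycle {4} _ ic) = c₄ ic
    by (cycle {5} _ ic) = c₅ ic
    by (cycle {0} () _)
    by (cycle {1} (s≤s ()) _)
    by (cycle {2} (s≤s (s≤s ())) _)
    -- In a cycle of length at least 6, neither g 2 nor g 4 is dominated by v = g 0.
    by (cycle {ℕ.suc (ℕ.suc (ℕ.suc (ℕ.suc (ℕ.suc (ℕ.suc j)))))} _ ic) = contradiction
      (doubleThreat {u = g 3} {t = g 1} {t′ = g 5}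
        (∈─N (B⊆U (g-∈ 2)) (far 0 (below 3))) (∈─N (B⊆U (g-∈ 4)) (far 2 (below 5)))
        (λ a y∈ → swap (nbrs 1 (below 2) a (-∈ y∈))) (NbrsIn-⊆ -∈ (nbrs 3 (below 4)))
        (distinct 1 5 (below 1) (below 5) λ ())) ns
      where
      open LobeFacts (leaf-lobe l) (rootAt ic w∈hull)
      below : ∀ i {_ : True (i ℕ.<? 6)} → i < 6 + j
      below i {p} = ℕ.≤-trans (toWitness p) (ℕ.m≤m+n 6 j)

  -- Staller claims the whole neighbourhood of v by forcing moves, u for every neighbour u of v other than ℓ;
  -- Dominator has to answer each u at t.
  record Forcing (U : Subset n) (v u x t : Fin n) : Set where
    field
      u~v  : u ~ v
      u∈U  : u ∈ U
      x∈U  : x ∈ U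
      x~u  : x ~ u
      x≁v  : ¬ x ~ v
      t≁v  : ¬ t ~ v
      x-nbrs : NbrsIn U x u t
      t-nbrs : ∃ λ s → s ~ v × NbrsIn U t x s

  -- Dominator's forced reply `t` must not spoil later threats. If it dominates `x′`, then `x′` is
  -- `x` or `s`; `s` is excluded as a neighbour of `v`, and `x` serves only the neighbour `u`, which
  -- is already played.
  Forcing-unique : ∀ {U v u x t u′ x′ t′} → Forcing U v u x t → Forcing U v u′ x′ t′ → x′ ~ t → u′ ≡ u
  Forcing-unique f f′ a with Forcing.t-nbrs f
  ... | s , s~v , h with h (~-sym a) (Forcing.x∈U f′)
  ...   | inj₂ refl = contradiction s~v (Forcing.x≁v f′)
  ...   | inj₁ refl with Forcing.x-nbrs f (Forcing.x~u f′) (Forcing.u∈U f′)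
  ...     | inj₁ e = e
  ...     | inj₂ refl = contradiction (Forcing.u~v f′) (Forcing.t≁v f)

  -- No forced reply is adjacent to `v`, so `v` stays undominated while its free neighbours
  -- disappear; the unforced neighbour `ℓ` is kept for the last move.
  sweep : ∀ {U v ℓ F A} → F ⊆ U → v ∈ A
        → (∀ u → u ∈ F → u ~ v → u ≡ ℓ ⊎ ∃ λ x → ∃ λ t → Forcing U v u x t × x ∈ A)
        → SW F A S-turn
  sweep {U} {v} {ℓ} {F₀} = go (⊂-wellFounded F₀)
    where
    go : ∀ {F A} → Acc _⊂_ F → F ⊆ U → v ∈ A
       → (∀ u → u ∈ F → u ~ v → u ≡ ℓ ⊎ ∃ λ x → ∃ λ t → Forcing U v u x t × x ∈ A)
       → SW F A S-turn
    go {F} {A} (acc rs) F⊆U v∈A force with any? (λ u → (u ∈? F) ×-dec (u ~? v) ×-dec ¬? (u ≟ ℓ))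
    ... | no ∄ = threat₁ v∈A λ {y} a y∈ → last y y∈ a (y ≟ ℓ)
      where
      last : ∀ y → y ∈ F → v ~ y → Dec (y ≡ ℓ) → y ≡ ℓ
      last y y∈ a (yes e) = e
      last y y∈ a (no y≢) = contradiction (y , y∈ , ~-sym a , y≢) ∄
    ... | yes (u , u∈ , u~v , u≢ℓ) with force u u∈ u~v
    ...   | inj₁ e = contradiction e u≢ℓ
    ...   | inj₂ (x , t , f , x∈A) = threat₂ x∈A (NbrsIn-⊆ F⊆U (Forcing.x-nbrs f))
              (go (rs (⊆-⊂-trans {i = F - u - t} -∈ (x∈p⇒p-x⊂p u∈))) (F⊆U ∘ -∈ ∘ -∈)
                (∈─N v∈A λ a → Forcing.t≁v f (~-sym a)) force′)
      where
      force′ : ∀ u′ → u′ ∈ F - u - t → u′ ~ v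
             → u′ ≡ ℓ ⊎ ∃ λ x′ → ∃ λ t′ → Forcing U v u′ x′ t′ × x′ ∈ A ─ N t
      force′ u′ u′∈ a with force u′ (-∈ (-∈ u′∈)) a
      ... | inj₁ e = inj₁ e
      ... | inj₂ (x′ , t′ , f′ , x′∈A) = inj₂ (x′ , t′ , f′
            , ∈─N x′∈A λ b → -≢ (-∈ u′∈) (Forcing-unique f f′ b))

  k₂-card : ∀ {k T} → IsK2 G T → 3 ≤ k → (c : Fin k → Fin n) → Injective _≡_ _≡_ c → ¬ (∀ i → c i ∈ T)
  k₂-card {1} _ (s≤s ())
  k₂-card {2} _ (s≤s (s≤s ()))
  k₂-card {ℕ.suc (ℕ.suc (ℕ.suc _))} (u , v , _ , _ , uv) _ c c-inj c-∈ =
    clash (to (uv _) (c-∈ zero)) (to (uv _) (c-∈ (suc zero))) (to (uv _) (c-∈ (suc (suc zero))))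
    where
    clash : c zero ≡ u ⊎ c zero ≡ v → c (suc zero) ≡ u ⊎ c (suc zero) ≡ v
          → c (suc (suc zero)) ≡ u ⊎ c (suc (suc zero)) ≡ v → ⊥
    clash (inj₁ p) (inj₁ q) _ = contradiction (c-inj (trans p (sym q))) λ ()
    clash (inj₂ p) (inj₂ q) _ = contradiction (c-inj (trans p (sym q))) λ ()
    clash (inj₁ p) _ (inj₁ q) = contradiction (c-inj (trans p (sym q))) λ ()
    clash (inj₂ p) _ (inj₂ q) = contradiction (c-inj (trans p (sym q))) λ ()
    clash _ (inj₁ p) (inj₁ q) = contradiction (c-inj (trans p (sym q))) λ ()
    clash _ (inj₂ p) (inj₂ q) = contradiction (c-inj (trans p (sym q))) λ ()

  -- The outcome on an arbitrary induced subgraph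

  data Outcome (U : Subset n) : Set where
    tiled   : ∀ {W} → Reduces G U W → (∀ x → x ∉ W) → Outcome U
    first   : ∀ {W} → Reduces G U W → NStarCactus G W → Outcome U
    staller : SW U U D-turn → Outcome U

  module Star (cactus : Cactus G ⊤) {U : Subset n} {v : Fin n} (v∈U : v ∈ U)
    (ns : ¬ SW (U - v) (U ─ N v) S-turn)
    (leafAt : ∀ y → y ∈ U - v → ∃ λ K → Leaf U v K × y ∈ K) where

    v∈A : v ∈ U ─ N v
    v∈A = ∈─N v∈U λ a → ~-≢ a refl

    leafShape : ∀ {K} (l : Leaf U v K) → Shape (Leaf.hull l)
    leafShape l = shape cactus (Leaf.w∈hull l) (Leaf.nonsep l)

    small : ∀ {K} (l : Leaf U v K) → SmallShape (Leaf.hull l)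
    small l = leaf-centred l (leafShape l) ns

    single : ∀ {K} (l : Leaf U v K) → U ⊆ Leaf.hull l → Outcome U
    single {K} l U⊆ with small l
    ... | k₂ (p , q , _ , _ , pq) = contradiction (threat₁ {t = proj₁ inner} v∈A
            λ {z} a z∈ → other (to (pq v) w∈hull) (to (pq _) (K⊆hull (proj₂ inner)))
              (to (pq z) (U⊆ (-∈ z∈))) (λ e → w∉K (subst (_∈ K) (sym e) (proj₂ inner))) (~-≢ a)) ns
      where
      open Leaf l
      other : ∀ {y z} → v ≡ p ⊎ v ≡ q → y ≡ p ⊎ y ≡ q → z ≡ p ⊎ z ≡ q → v ≢ y → v ≢ z → z ≡ y
      other (inj₁ refl) (inj₁ refl) _ n _ = contradiction refl n
      other (inj₂ refl) (inj₂ refl) _ n _ = contradiction refl n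
      other (inj₁ refl) _ (inj₁ refl) _ n = contradiction refl n
      other (inj₂ refl) _ (inj₂ refl) _ n = contradiction refl n
      other _ (inj₁ refl) (inj₁ refl) _ _ = refl
      other _ (inj₂ refl) (inj₂ refl) _ _ = refl
    ... | c₃ ic = first stop (inj₁ (InducesCycle-cong (Leaf.hull⊆U l) U⊆ ic))
    ... | c₄ ic = tiled (remove (Leaf.hull l) (leaf-endBlock l) ic stop)
            λ x x∈ → x∈p─q⇒x∉q x∈ (U⊆ (─-∈ x∈))
    -- The move `g 1` threatens both `v`, whose other neighbour is `g 4`, and `g 2`, whose other
    -- neighbour is `g 3`.
    ... | c₅ ic = contradiction (doubleThreat {u = g 1} {t = g 4} {t′ = g 3}
            (subst (_∈ _) (sym root) v∈A) (∈─N (B⊆U (g-∈ 2)) (far 0 lt)) around (NbrsIn-⊆ -∈ (nbrs 1 lt))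
            (distinct 4 3 lt lt λ ())) ns
      where
      open LobeFacts (leaf-lobe l) (rootAt ic (Leaf.w∈hull l))
      around : NbrsIn (U - v) (g 0) (g 1) (g 4)
      around a y∈ = rootNbr refl (U⊆ (-∈ y∈)) (subst (_~ _) root a)

    module _ {y z : Fin n} (y∈ : y ∈ U - v) (z∈ : z ∈ U)
      (z∉ : z ∉ Leaf.hull (proj₁ (proj₂ (leafAt y y∈)))) where

      block-hull : ∀ {T} → IsBlock G U T → ∃ λ K → Σ (Leaf U v K) λ l → T ≡ Leaf.hull l
      block-hull {T} (T⊆U , _ , nT , mT) with any? (λ t → (t ∈? T) ×-dec ¬? (t ≟ v))
      ... | yes (t , t∈ , t≢v) with leafAt t (x∈p∧x≢y⇒x∈p-y (T⊆U t∈) t≢v)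
      ...   | K , l , t∈K = K , l , ⊆-antisym T⊆ (mT _ T⊆ (Leaf.hull⊆U l) (Leaf.nonsep l))
        where
        T⊆ : T ⊆ Leaf.hull l
        T⊆ = Branch-absorbs (Leaf.branch l) T⊆U nT t∈ t∈K
      -- A block with no vertex besides `v` would lie in every hull, so the leaf at `y` serves.
      block-hull {T} (T⊆U , _ , nT , mT) | no ∄ with leafAt y y∈
      ... | K , l , y∈K = K , l , ⊆-antisym T⊆ (mT _ T⊆ (Leaf.hull⊆U l) (Leaf.nonsep l))
        where
        T⊆ : T ⊆ Leaf.hull l
        T⊆ {t} t∈ with t ≟ v
        ... | yes refl = Leaf.w∈hull l
        ... | no t≢ = contradiction (t , t∈ , t≢) ∄

      connected : Connected G U
      connected x x′ x∈ x′∈ = Reach-trans (toV x x∈) (Reach-sym (toV x′ x′∈))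
        where
        toV : ∀ x → x ∈ U → Reach G U x v
        toV x x∈ with x ≟ v
        ... | yes refl = here x∈
        ... | no x≢ with leafAt x (x∈p∧x≢y⇒x∈p-y x∈ x≢)
        ...   | K , l , x∈K = Reach-mono (Leaf.hull⊆U l)
                (proj₁ (Leaf.nonsep l) x v (Leaf.K⊆hull l x∈K) (Leaf.w∈hull l))

      starCactus : StarCactus G U
      starCactus = (connected , kinds) , v , v∈U , centre
        where
        kinds : ∀ B → IsBlock G U B → (∃ λ k → 3 ≤ k × InducesCycle G k B) ⊎ IsK2 G B
        kinds B isB with block-hull isB
        ... | K , l , refl with small l
        ...   | k₂ e = inj₂ e
        ...   | c₃ ic = inj₁ (3 , s≤s (s≤s (s≤s z≤n)) , ic)
        ...   | c₄ ic = inj₁ (4 , s≤s (s≤s (s≤s z≤n)) , ic)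
        ...   | c₅ ic = inj₁ (5 , s≤s (s≤s (s≤s z≤n)) , ic)
        centre : ∀ B → IsBlock G U B → v ∈ B
        centre B isB with block-hull isB
        ... | _ , l , refl = Leaf.w∈hull l

      z∈′ : z ∈ U - v
      z∈′ = x∈p∧x≢y⇒x∈p-y z∈ λ { refl → z∉ (Leaf.w∈hull (proj₁ (proj₂ (leafAt y y∈)))) }

      twoBlocks : AtLeastTwoBlocks G U
      twoBlocks with leafAt z z∈′
      ... | K , l , z∈K = _ , _ , leaf-block (proj₁ (proj₂ (leafAt y y∈))) , leaf-block l
            , λ e → z∉ (subst (z ∈_) (sym e) (Leaf.K⊆hull l z∈K))

      short : ∀ k → HasCycle G U k → k ≤ 5
      short k (3≤k , c , c-inj , c-U , c-adj) = bound (offV k 3≤k c c-inj)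
        where
        -- A vertex of the cycle other than `v` determines the hull that absorbs the entire cycle.
        offV : ∀ k → 3 ≤ k → (c : Fin k → Fin n) → Injective _≡_ _≡_ c → ∃ λ i → c i ≢ v
        offV (ℕ.suc (ℕ.suc _)) _ c c-inj with c zero ≟ v
        ... | no ≢ = zero , ≢
        ... | yes e = suc zero , λ e′ → contradiction (c-inj (trans e (sym e′))) λ ()
        offV (ℕ.suc 0) (s≤s ()) _ _
        bound : (∃ λ i → c i ≢ v) → k ≤ 5
        bound (i , ci≢v) with leafAt (c i) (x∈p∧x≢y⇒x∈p-y (c-U i) ci≢v)
        ... | K , l , ci∈K = by (small l)
          where
          inside : ∀ {x} → x ∈ image c → x ∈ Leaf.hull l
          inside = Branch-absorbs (Leaf.branch l) (λ x∈ → let (j , e) = ∈-image⁻ c x∈ in subst (_∈ U) e (c-U j))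
            (Nonseparable-image c c-inj c-adj) (∈-image c i) ci∈K
          by : SmallShape (Leaf.hull l) → k ≤ 5
          by (k₂ e) = contradiction (λ j → inside (∈-image c j)) (k₂-card e 3≤k c c-inj)
          by (c₃ ic) = ℕ.≤-trans (cycleSize-≤ inside c c-inj (∈-image c) ic) (s≤s (s≤s (s≤s z≤n)))
          by (c₄ ic) = ℕ.≤-trans (cycleSize-≤ inside c c-inj (∈-image c) ic) (s≤s (s≤s (s≤s (s≤s z≤n))))
          by (c₅ ic) = cycleSize-≤ inside c c-inj (∈-image c) ic

      PentagonAt EdgeAt : Fin n → Set
      PentagonAt y = ∃ λ K → Σ (Leaf U v K) λ l → y ∈ K × InducesCycle G 5 (Leaf.hull l)
      EdgeAt y = ∃ λ K → Σ (Leaf U v K) λ l → y ∈ K × IsK2 G (Leaf.hull l)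

      -- The path off `v` is `g 1`, `g 2`, `g 3`, `g 4`: taking `g 1` forces `g 3` because of `g 2`,
      -- and taking `g 4` forces `g 2` because of `g 3`.
      pentagon-forcing : ∀ {u} → u ~ v → PentagonAt u → ∃ λ x → ∃ λ t → Forcing U v u x t × x ∈ U ─ N v
      pentagon-forcing {u} u~v (K , l , u∈K , ic) = by (rootNbr refl (Leaf.K⊆hull l u∈K) (~-sym u~v))
        where
        open LobeFacts (leaf-lobe l) (rootAt ic (Leaf.w∈hull l))
        by : u ≡ g 1 ⊎ u ≡ g 4 → ∃ λ x → ∃ λ t → Forcing U v u x t × x ∈ U ─ N v
        by (inj₁ refl) = g 2 , g 3 , record
          { u~v = u~v ; u∈U = B⊆U (g-∈ 1) ; x∈U = B⊆U (g-∈ 2) ; x~u = ~-sym (adj 1)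
          ; x≁v = far 0 lt ; t≁v = far 1 lt ; x-nbrs = nbrs 1 lt
          ; t-nbrs = g 4 , subst (g 4 ~_) (trans wrap root) (adj 4) , nbrs 2 lt }
          , ∈─N (B⊆U (g-∈ 2)) (far 0 lt)
        by (inj₂ refl) = g 3 , g 2 , record
          { u~v = u~v ; u∈U = B⊆U (g-∈ 4) ; x∈U = B⊆U (g-∈ 3) ; x~u = adj 3
          ; x≁v = far 1 lt ; t≁v = far 0 lt ; x-nbrs = λ a y∈ → swap (nbrs 2 lt a y∈)
          ; t-nbrs = g 1 , subst (g 1 ~_) root (~-sym (adj 0)) , λ a y∈ → swap (nbrs 1 lt a y∈) }
          , ∈─N (B⊆U (g-∈ 3)) (far 1 lt)

      pentagons : ∀ ℓ → (∀ u → u ∈ U - v → u ≡ ℓ ⊎ PentagonAt u) → ⊥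
      pentagons ℓ h = ns (sweep -∈ v∈A λ u u∈ u~v → [ inj₁ , inj₂ ∘ pentagon-forcing u~v ]′ (h u u∈))

      edgeHulls-≢ : ∀ {a b} → a ≢ b → (p : EdgeAt a) (q : EdgeAt b)
                  → Leaf.hull (proj₁ (proj₂ p)) ≢ Leaf.hull (proj₁ (proj₂ q))
      edgeHulls-≢ {a} {b} a≢b (K , l , a∈ , (s , t , _ , _ , st)) (K′ , l′ , b∈ , _) e =
        clash (to (st a) (Leaf.K⊆hull l a∈)) (to (st b) (subst (b ∈_) (sym e) (Leaf.K⊆hull l′ b∈)))
          (to (st v) (Leaf.w∈hull l))
        where
        v≢a : v ≢ a
        v≢a refl = Leaf.w∉K l a∈
        v≢b : v ≢ b
        v≢b refl = Leaf.w∉K l′ b∈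
        clash : a ≡ s ⊎ a ≡ t → b ≡ s ⊎ b ≡ t → v ≡ s ⊎ v ≡ t → ⊥
        clash (inj₁ refl) (inj₁ refl) _ = a≢b refl
        clash (inj₂ refl) (inj₂ refl) _ = a≢b refl
        clash (inj₁ refl) _ (inj₁ refl) = v≢a refl
        clash (inj₂ refl) _ (inj₂ refl) = v≢a refl
        clash _ (inj₁ refl) (inj₁ refl) = v≢b refl
        clash _ (inj₂ refl) (inj₂ refl) = v≢b refl

      Winning : Set
      Winning = HasCycle G U 3 ⊎ HasCycle G U 4 ⊎ (Σ (Subset n) λ B₁ → Σ (Subset n) λ B₂ →
                  IsBlock G U B₁ × IsBlock G U B₂ × B₁ ≢ B₂ × IsK2 G B₁ × IsK2 G B₂)

      winning : Winning
      winning with search {A = λ u → u ∈ U - v → EdgeAt u ⊎ PentagonAt u} {B = λ _ → Winning} try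
        where
        try : ∀ u → (u ∈ U - v → EdgeAt u ⊎ PentagonAt u) ⊎ Winning
        try u with u ∈? (U - v)
        ... | no u∉ = inj₁ λ u∈ → contradiction u∈ u∉
        ... | yes u∈ with leafAt u u∈
        ...   | K , l , u∈K with small l
        ...     | k₂ e = inj₁ λ _ → inj₁ (K , l , u∈K , e)
        ...     | c₅ ic = inj₁ λ _ → inj₂ (K , l , u∈K , ic)
        ...     | c₃ ic = inj₂ (inj₁ (InducesCycle⇒HasCycle (s≤s (s≤s (s≤s z≤n))) (Leaf.hull⊆U l) ic))
        ...     | c₄ ic = inj₂ (inj₂ (inj₁ (InducesCycle⇒HasCycle (s≤s (s≤s (s≤s z≤n))) (Leaf.hull⊆U l) ic)))
      ... | inj₂ (_ , w) = w
      ... | inj₁ kinds with search {A = λ u → u ∈ U - v → PentagonAt u} {B = EdgeAt} try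
        where
        try : ∀ u → (u ∈ U - v → PentagonAt u) ⊎ EdgeAt u
        try u with u ∈? (U - v)
        ... | no u∉ = inj₁ λ u∈ → contradiction u∈ u∉
        ... | yes u∈ with kinds u u∈
        ...   | inj₁ e = inj₂ e
        ...   | inj₂ p = inj₁ λ _ → p
      -- There is no `K₂` to be exempted; `v` is a dummy for `ℓ`, as it is not in `U - v`.
      ...   | inj₁ ps = ⊥-elim (pentagons v λ u u∈ → inj₂ (ps u u∈))
      ...   | inj₂ (ℓ , e) with search {A = λ u → u ∈ U - v → u ≡ ℓ ⊎ PentagonAt u}
                                       {B = λ u → u ≢ ℓ × EdgeAt u} try
        where
        try : ∀ u → (u ∈ U - v → u ≡ ℓ ⊎ PentagonAt u) ⊎ (u ≢ ℓ × EdgeAt u)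
        try u with u ∈? (U - v) | u ≟ ℓ
        ... | no u∉ | _ = inj₁ λ u∈ → contradiction u∈ u∉
        ... | yes _ | yes eq = inj₁ λ _ → inj₁ eq
        ... | yes u∈ | no u≢ with kinds u u∈
        ...   | inj₁ e′ = inj₂ (u≢ , e′)
        ...   | inj₂ p = inj₁ λ _ → inj₂ p
      ...     | inj₁ ps = ⊥-elim (pentagons ℓ ps)
      ...     | inj₂ (u , u≢ℓ , e′) = inj₂ (inj₂ (_ , _ , leaf-block (proj₁ (proj₂ e′))
                  , leaf-block (proj₁ (proj₂ e)) , edgeHulls-≢ u≢ℓ e′ e
                  , proj₂ (proj₂ (proj₂ e′)) , proj₂ (proj₂ (proj₂ e))))

      nStar : NStarCactus G U
      nStar = inj₂ (starCactus , twoBlocks , short , winning)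

    outcome : Outcome U
    outcome with nonempty? (U - v)
    ... | no ∄ = contradiction (won v∈A λ y _ y∈ → ∄ (y , y∈)) ns
    ... | yes (y , y∈) with any? (λ z → (z ∈? U) ×-dec ¬? (z ∈? Leaf.hull (proj₁ (proj₂ (leafAt y y∈)))))
    ...   | yes (z , z∈ , z∉) = first stop (nStar y∈ z∈ z∉)
    ...   | no ∄ = single (proj₁ (proj₂ (leafAt y y∈))) U⊆
      where
      U⊆ : U ⊆ Leaf.hull (proj₁ (proj₂ (leafAt y y∈)))
      U⊆ {z} z∈ with z ∈? Leaf.hull (proj₁ (proj₂ (leafAt y y∈)))
      ... | yes z∈h = z∈h
      ... | no z∉ = contradiction (z , z∈ , z∉) ∄

  trichotomy : Cactus G ⊤ → ∀ U → Outcome U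
  trichotomy cactus U = go U (⊂-wellFounded U)
    where
    go : ∀ U → Acc _⊂_ U → Outcome U
    go U (acc rs) with nonempty? U | SW? U U D-turn
    ... | no ∄ | _ = tiled stop λ x x∈ → ∄ (x , x∈)
    ... | yes _ | inj₁ s = staller s
    ... | yes ne | inj₂ ns with ¬SW⇒Dmove ne ns
    ...   | v , v∈ , ns′ with search {A = λ y → y ∈ U - v → ∃ λ K → Leaf U v K × y ∈ K}
                                     {B = λ _ → Outcome U} try
      where
      try : ∀ y → (y ∈ U - v → ∃ λ K → Leaf U v K × y ∈ K) ⊎ Outcome U
      try y with y ∈? (U - v)
      ... | no y∉ = inj₁ λ y∈ → contradiction y∈ y∉
      ... | yes y∈ with componentLeaf v∈ (component y∈)
      ...   | inj₁ l = inj₁ λ _ → _ , l , Component.x∈R (component y∈)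
      ...   | inj₂ (inj₁ (x , x∈ , iso)) = contradiction (won x∈ iso) ns
      ...   | inj₂ (inj₂ (w , K , l , v∉)) with leaf-avoided l (shape cactus (Leaf.w∈hull l) (Leaf.nonsep l)) v∈ v∉
      ...     | inj₁ s = contradiction s ns′
      ...     | inj₂ ic with go (U ─ Leaf.hull l) (rs (p∩q≢∅⇒p─q⊂p U (Leaf.hull l)
                  (w , x∈p∩q⁺ (Leaf.w∈U l , Leaf.w∈hull l))))
      ...       | tiled r e = inj₂ (tiled (remove _ (leaf-endBlock l) ic r) e)
      ...       | first r e = inj₂ (first (remove _ (leaf-endBlock l) ic r) e)
      -- If Staller wins the D-game without the `C₄`, she also wins there after Dominator's `v`.
      -- Playing out the `C₄` first, she would then win on `U` after `v`, against the choice of `v`.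
      ...       | staller s = contradiction (removeC4-S (leaf-lobe l) ic -∈ ─-∈
                  (λ x∈ x≢ → ∈─N (Leaf.hull⊆U l x∈) λ a → v∉ (Lobe.closed (leaf-lobe l) x∈ x≢ v∈ a))
                  (SW-mono (SW-afterD (x∈p∧x∉q⇒x∈p─q v∈ v∉) s) S≼S
                    (λ x∈ → x∈p∧x∉q⇒x∈p─q (∈─N (─-∈ (─-∈ x∈)) (∈─N⁻ x∈)) (x∈p─q⇒x∉q (─-∈ x∈)))
                    λ _ _ y∈ → x∈p∧x≢y⇒x∈p-y (x∈p∧x∉q⇒x∈p─q (-∈ (─-∈ y∈)) (x∈p─q⇒x∉q y∈)) (-≢ (─-∈ y∈)))) ns′
    ...     | inj₁ leafAt = Star.outcome cactus v∈ ns′ leafAt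
    ...     | inj₂ (_ , o) = o

  -- Removing 4-cycles

  -- The two neighbours `y`, `z` of `x` are opposite vertices, and opposite vertices of a `C₄` have
  -- the same neighbours in it.
  c₄-opposite : ∀ {C x y z x′} → InducesCycle G 4 C → x ∈ C → y ∈ C → z ∈ C → x′ ∈ C
              → x ~ y → x ~ z → y ≢ z → x′ ~ y → x′ ~ z
  c₄-opposite {C} {x} {y} {z} {x′} ic x∈ y∈ z∈ x′∈ xy xz y≢z x′y =
    subst (x′ ~_) (sym (z≡ (rootNbr refl x∈ (~-sym xy)))) (meet (rootNbr refl x′∈ (~-sym x′y)))
    where
    open LoopFacts (rootAt ic y∈)
    z≡ : x ≡ g 1 ⊎ x ≡ g 3 → z ≡ g 2
    z≡ (inj₁ refl) with nbr 0 z∈ xz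
    ... | inj₁ e = contradiction (sym (trans e root)) y≢z
    ... | inj₂ e = e
    z≡ (inj₂ refl) with nbr 2 z∈ xz
    ... | inj₁ e = e
    ... | inj₂ e = contradiction (sym (trans e (trans wrap root))) y≢z
    meet : x′ ≡ g 1 ⊎ x′ ≡ g 3 → x′ ~ g 2
    meet (inj₁ refl) = adj 1
    meet (inj₂ refl) = ~-sym (adj 2)

  -- Each vertex is guarded by its two neighbours in its own tile. The index type is arbitrary in
  -- order to cover a full partition as well as one `C₄` removed from a larger graph.
  module Tiling {I : Set} (C : I → Subset n) (ic : ∀ i → InducesCycle G 4 (C i))
    (disjoint : ∀ {x i j} → x ∈ C i → x ∈ C j → i ≡ j) where

    P : Fin n → Fin n → Fin n → Set
    P x y z = ∃ λ i → (x ∈ C i × y ∈ C i × z ∈ C i) × (x ~ y × x ~ z × y ≢ z)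

    P-share : ∀ {x y z x′ y′ z′ s} → P x y z → P x′ y′ z′ → s ≡ y ⊎ s ≡ z → s ≡ y′ ⊎ s ≡ z′
            → x′ ~ y × x′ ~ z
    P-share {s = s} (i , (x∈ , y∈ , z∈) , (xy , xz , y≢z)) (j , (x′∈ , y′∈ , z′∈) , (xy′ , xz′ , _)) e e′ =
      by e (tile e′)
      where
      tile : s ≡ _ ⊎ s ≡ _ → s ∈ C j × _ ~ s
      tile (inj₁ refl) = y′∈ , xy′
      tile (inj₂ refl) = z′∈ , xz′
      by : s ≡ _ ⊎ s ≡ _ → s ∈ C j × _ ~ s → _ ~ _ × _ ~ _
      by (inj₁ refl) (s∈ , a) with disjoint y∈ s∈
      ... | refl = a , c₄-opposite (ic i) x∈ y∈ z∈ x′∈ xy xz y≢z a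
      by (inj₂ refl) (s∈ , a) with disjoint z∈ s∈
      ... | refl = c₄-opposite (ic i) x∈ z∈ y∈ x′∈ xz xy (y≢z ∘ sym) a , a

    open Pairing P (proj₂ ∘ proj₂) P-share public

    pair-in : ∀ {x i} → x ∈ C i → ∃ λ y → ∃ λ z → P x y z × y ∈ C i × z ∈ C i
    pair-in {x} {i} x∈ = g 1 , g 3 , (i , (x∈ , g-∈ 1 , g-∈ 3)
        , (subst (_~ g 1) root (adj 0) , subst (_~ g 3) (trans wrap root) (~-sym (adj 3)) , distinct 1 3 lt lt λ ()))
        , g-∈ 1 , g-∈ 3
      where open LoopFacts (rootAt (ic i) x∈)

  C4Partition⇒¬SW : C4Partition G → ¬ SW ⊤ ⊤ S-turn
  C4Partition⇒¬SW (m , C , ic , cov , dis) s = ∉⊥ (proj₂ (SW⇒nonempty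
      (pairing {F′ = ∅} {A′ = ∅} (λ _ → ∈⊤) inv s)))
    where
    open Tiling C ic (λ {x} {i} {j} → dis x i j)
    inv : ∀ x → x ∈ ⊤ → Paired ⊤ ∅ ∅ x
    inv x _ with cov x
    ... | i , x∈ with pair-in x∈
    ...   | y , z , p , _ = inj₂ (y , z , p , (∈⊤ , ∈⊤) , ∉⊥ , ∉⊥)

  removeC4-D : ∀ {U C t} → C ⊆ U → InducesCycle G 4 C → SW U U t → SW (U ─ C) (U ─ C) t
  removeC4-D {U} {C} C⊆U ic = pairing ─-∈ inv
    where
    open Tiling {One} (λ _ → C) (λ _ → ic) (λ _ _ → refl)
    inv : ∀ x → x ∈ U → Paired U (U ─ C) (U ─ C) x
    inv x x∈ with x ∈? C
    ... | no x∉ = inj₁ (x∈p∧x∉q⇒x∈p─q x∈ x∉)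
    ... | yes x∈C with pair-in x∈C
    ...   | y , z , p , y∈ , z∈ = inj₂ (y , z , p , (C⊆U y∈ , C⊆U z∈)
              , (λ y∉ → x∈p─q⇒x∉q y∉ y∈) , λ z∉ → x∈p─q⇒x∉q z∉ z∈)

  Tiles : Subset n → Set
  Tiles U = Σ ℕ λ m → Σ (Fin m → Subset n) λ P →
    (∀ i → InducesCycle G 4 (P i)) × (∀ x → x ∈ U → ∃ λ i → x ∈ P i)
    × (∀ i {x} → x ∈ P i → x ∈ U) × (∀ x i j → x ∈ P i → x ∈ P j → i ≡ j)

  Reduces⇒Tiles : ∀ {U W} → Reduces G U W → (∀ x → x ∉ W) → Tiles U
  Reduces⇒Tiles stop e = 0 , (λ ()) , (λ ()) , (λ x x∈ → contradiction x∈ (e x)) , (λ ()) , λ _ ()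
  Reduces⇒Tiles {U} (remove C ((C⊆U , _) , _) ic r) e with Reduces⇒Tiles r e
  ... | m , P , ics , cov , sub , dis = ℕ.suc m , P′ , ics′ , cov′ , sub′ , dis′
    where
    P′ : Fin (ℕ.suc m) → Subset n
    P′ zero = C
    P′ (suc i) = P i
    ics′ : ∀ i → InducesCycle G 4 (P′ i)
    ics′ zero = ic
    ics′ (suc i) = ics i
    cov′ : ∀ x → x ∈ U → ∃ λ i → x ∈ P′ i
    cov′ x x∈ with x ∈? C
    ... | yes x∈C = zero , x∈C
    ... | no x∉ with cov x (x∈p∧x∉q⇒x∈p─q x∈ x∉)
    ...   | i , x∈P = suc i , x∈P
    sub′ : ∀ i {x} → x ∈ P′ i → x ∈ U
    sub′ zero = C⊆U
    sub′ (suc i) = ─-∈ ∘ sub i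
    dis′ : ∀ x i j → x ∈ P′ i → x ∈ P′ j → i ≡ j
    dis′ x zero zero _ _ = refl
    dis′ x zero (suc j) x∈C x∈P = contradiction x∈C (x∈p─q⇒x∉q (sub j x∈P))
    dis′ x (suc i) zero x∈P x∈C = contradiction x∈C (x∈p─q⇒x∉q (sub i x∈P))
    dis′ x (suc i) (suc j) a b = cong suc (dis x i j a b)

  Reduces⇒C4Partition : ∀ {W} → Reduces G ⊤ W → (∀ x → x ∉ W) → C4Partition G
  Reduces⇒C4Partition r e with Reduces⇒Tiles r e
  ... | m , P , ics , cov , _ , dis = m , P , ics , (λ x → cov x ∈⊤) , dis

  -- An edge leaving `C` puts its end in `C` into a second block, and by the end-block condition
  -- only one vertex of `C` can be such an end. If no edge leaves, any vertex serves as `w`.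
  endBlock-lobe : ∀ {U C x} → IsEndBlock G U C → x ∈ C → ∃ λ w → Lobe U w C
  endBlock-lobe {U} {C} {x₀} ((C⊆U , _) , end) x₀∈
    with any? (λ x → any? λ y → (x ∈? C) ×-dec (y ∈? U) ×-dec ¬? (y ∈? C) ×-dec (x ~? y))
  ... | yes (w , y , w∈ , y∈ , y∉ , a) = w , record { B⊆U = C⊆U ; w∈B = w∈ ; closed = closed }
    where
    exit : ∀ {x y} → x ∈ C → y ∈ U → y ∉ C → x ~ y → ∃ λ B → IsBlock G U B × B ≢ C × x ∈ B
    exit x∈ y∈ y∉ a with edge-block (C⊆U x∈) y∈ a
    ... | B , isB , x∈B , y∈B = B , isB , (λ { refl → y∉ y∈B }) , x∈B
    closed : ∀ {x y} → x ∈ C → x ≢ w → y ∈ U → x ~ y → y ∈ C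
    closed {x} {z} x∈ x≢w z∈ b with z ∈? C
    ... | yes z∈C = z∈C
    ... | no z∉ = contradiction (end x w x∈ w∈ (exit x∈ z∈ z∉ b) (exit w∈ y∈ y∉ a)) x≢w
  ... | no ∄ = x₀ , record { B⊆U = C⊆U ; w∈B = x₀∈ ; closed = closed }
    where
    closed : ∀ {x y} → x ∈ C → x ≢ x₀ → y ∈ U → x ~ y → y ∈ C
    closed {x} {y} x∈ _ y∈ a with y ∈? C
    ... | yes y∈C = y∈C
    ... | no y∉ = contradiction (x , y , x∈ , y∈ , y∉ , a) ∄

  Reduces-D : ∀ {U W t} → Reduces G U W → SW U U t → SW W W t
  Reduces-D stop s = s
  Reduces-D (remove C ((C⊆U , _) , _) ic r) s = Reduces-D r (removeC4-D C⊆U ic s)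

  Reduces-S : ∀ {U W} → Reduces G U W → SW W W S-turn → SW U U S-turn
  Reduces-S stop s = s
  Reduces-S (remove C eb@((C⊆U , (x , x∈) , _) , _) ic r) s =
    removeC4-S (proj₂ (endBlock-lobe eb x∈)) ic id id (λ y∈ _ → C⊆U y∈) (Reduces-S r s)

  -- 𝒩-star cacti

  triangle-S : ∀ {W} → InducesCycle G 3 W → SW W W S-turn
  triangle-S {W} ic@(c , _ , c-W , _) = doubleThreat {u = g 0} (g-∈ 1) (g-∈ 2) (λ a y∈ → nbr 0 y∈ a) last
      (distinct 2 1 lt lt λ ())
    where
    open LoopFacts (rootAt ic (from (c-W _) (zero , refl)))
    last : NbrsIn W (g 2) (g 0) (g 1)
    last a y∈ with nbr 1 y∈ a
    ... | inj₁ e = inj₂ e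
    ... | inj₂ e = inj₁ (trans e wrap)

  -- After a first move at any vertex only that vertex is undominated, and the other two form its
  -- pair.
  triangle-D : ∀ {W} → InducesCycle G 3 W → ¬ SW W W D-turn
  triangle-D {W} ic@(c , _ , c-W , _) s = ∉⊥ (proj₂ (SW⇒nonempty
      (pairing {F′ = ∅} {A′ = ∅} (λ z∈ → contradiction z∈ ∉⊥) inv (SW-afterD w∈ s))))
    where
    w∈ : c zero ∈ W
    w∈ = from (c-W _) (zero , refl)
    open LoopFacts (rootAt ic w∈)
    w = c zero
    P : Fin n → Fin n → Fin n → Set
    P x y z = x ≡ w × y ≡ g 1 × z ≡ g 2
    w~1 : w ~ g 1
    w~1 = subst (_~ g 1) root (adj 0)
    w~2 : w ~ g 2
    w~2 = subst (_~ g 2) (trans wrap root) (~-sym (adj 2))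
    P-adj : ∀ {x y z} → P x y z → x ~ y × x ~ z × y ≢ z
    P-adj (refl , refl , refl) = w~1 , w~2 , distinct 1 2 lt lt λ ()
    P-share : ∀ {x y z x′ y′ z′ s} → P x y z → P x′ y′ z′ → s ≡ y ⊎ s ≡ z → s ≡ y′ ⊎ s ≡ z′
            → x′ ~ y × x′ ~ z
    P-share (refl , refl , refl) (refl , _) _ _ = w~1 , w~2
    open Pairing P P-adj P-share
    inv : ∀ x → x ∈ W ─ N w → Paired (W - w) ∅ ∅ x
    inv x x∈ with cover (─-∈ x∈)
    ... | 0 , _ , e = inj₂ (g 1 , g 2 , (trans (sym e) root , refl , refl)
          , (x∈p∧x≢y⇒x∈p-y (g-∈ 1) (≢root 0 lt) , x∈p∧x≢y⇒x∈p-y (g-∈ 2) (≢root 1 lt)) , ∉⊥ , ∉⊥)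
    ... | 1 , _ , refl = contradiction (~-sym w~1) (∈─N⁻ x∈)
    ... | 2 , _ , refl = contradiction (~-sym w~2) (∈─N⁻ x∈)
    ... | ℕ.suc (ℕ.suc (ℕ.suc _)) , s≤s (s≤s (s≤s ())) , _

  module _ {W : Subset n} {v : Fin n} (cactus : Cactus G W) (v∈W : v ∈ W) (centre : ∀ B → IsBlock G W B → v ∈ B)
    (short : ∀ k → HasCycle G W k → k ≤ 5) where

    -- An edge at `x` lies in a block containing `x` and `v`, and by `block-unique` that block is
    -- `B`.
    block-lobe : ∀ {B} → IsBlock G W B → Lobe W v B
    block-lobe {B} isB = record { B⊆U = proj₁ isB ; w∈B = centre B isB ; closed = closed }
      where
      closed : ∀ {x y} → x ∈ B → x ≢ v → y ∈ W → x ~ y → y ∈ B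
      closed x∈ x≢ y∈ a with edge-block (proj₁ isB x∈) y∈ a
      ... | B′ , isB′ , x∈′ , y∈′ = subst (_ ∈_)
            (block-unique isB′ isB x≢ x∈′ x∈ (centre B′ isB′) (centre B isB)) y∈′

    k₂-other : ∀ {B} → IsBlock G W B → IsK2 G B → ∃ λ u → u ∈ B × u ≢ v × u ~ v × (∀ {y} → y ∈ B → y ≢ v → y ≡ u)
    k₂-other {B} isB (p , q , p≢q , a , pq) with to (pq v) (centre B isB)
    ... | inj₁ refl = q , from (pq q) (inj₂ refl) , (p≢q ∘ sym) , ~-sym a
          , λ y∈ y≢ → [ (λ e → contradiction e y≢) , id ]′ (to (pq _) y∈)
    ... | inj₂ refl = p , from (pq p) (inj₁ refl) , p≢q , a
          , λ y∈ y≢ → [ id , (λ e → contradiction e y≢) ]′ (to (pq _) y∈)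

    k₂-leaf : ∀ {B u} → IsBlock G W B → u ∈ B → u ≢ v → (∀ {y} → y ∈ B → y ≢ v → y ≡ u)
            → ∀ {y} → u ~ y → y ∈ W → y ≡ v
    k₂-leaf {B} {u} isB u∈ u≢ only {y} a y∈ with y ≟ v
    ... | yes e = e
    ... | no y≢ = contradiction (sym (only (Lobe.closed (block-lobe isB) u∈ u≢ y∈ a) y≢)) (~-≢ a)

    blockShape : ∀ {B} → IsBlock G W B → SmallShape B
    blockShape {B} isB with proj₂ cactus B isB
    ... | inj₂ e = k₂ e
    ... | inj₁ (k , 3≤k , ic) = by k ic 3≤k (short k (InducesCycle⇒HasCycle 3≤k (proj₁ isB) ic))
      where
      by : ∀ k → InducesCycle G k B → 3 ≤ k → k ≤ 5 → SmallShape B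
      by 0 _ () _
      by 1 _ (s≤s ()) _
      by 2 _ (s≤s (s≤s ())) _
      by 3 ic _ _ = c₃ ic
      by 4 ic _ _ = c₄ ic
      by 5 ic _ _ = c₅ ic
      by (ℕ.suc (ℕ.suc (ℕ.suc (ℕ.suc (ℕ.suc (ℕ.suc _)))))) _ _ (s≤s (s≤s (s≤s (s≤s (s≤s ())))))

    -- `HasCycle` allows chords. The vertex set of the cycle is nonseparable, so it fills a cycle
    -- block by `cycle-minimal`, and the lengths agree.
    cycleBlock : ∀ {k} → HasCycle G W k → ∃ λ B → IsBlock G W B × InducesCycle G k B
    cycleBlock {k@(ℕ.suc (ℕ.suc (ℕ.suc _)))} (3≤k , c , c-inj , c-W , c-adj)
      with extendToBlock (∈-image c zero) (λ x∈ → let (j , e) = ∈-image⁻ c x∈ in subst (_∈ W) e (c-W j))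
             (Nonseparable-image c c-inj c-adj)
    ... | B , isB , T⊆B with proj₂ cactus B isB
    ...   | inj₂ e = contradiction (λ i → T⊆B (∈-image c i)) (k₂-card e 3≤k c c-inj)
    ...   | inj₁ (j , 3≤j , ic@(d , d-inj , d-B , _)) = B , isB
              , subst (λ l → InducesCycle G l B) (ℕ.≤-antisym j≤k k≤j) ic
      where
      B⊆T : B ⊆ image c
      B⊆T = cycle-minimal (Nonseparable-image c c-inj c-adj) (_ , _ , _
        , (∈-image c zero , ∈-image c (suc zero) , ∈-image c (suc (suc zero)))
        , ((λ e → contradiction (c-inj e) λ ()) , (λ e → contradiction (c-inj e) λ ()) , λ e → contradiction (c-inj e) λ ()))
        T⊆B ic
      k≤j : k ≤ j
      k≤j = cycleSize-≤ T⊆B c c-inj (∈-image c) ic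
      j≤k : j ≤ k
      j≤k = preimages-≤ d c d-inj λ i → ∈-image⁻ c (B⊆T (from (d-B _) (i , refl)))
    cycleBlock {1} (s≤s () , _)
    cycleBlock {2} (s≤s (s≤s ()) , _)

    data Threat (B : Subset n) : Set where
      leaf : ∀ x → x ∈ W → (∀ {y} → x ~ y → y ∈ W → y ≡ v) → Threat B
      fork : ∀ x t → x ∈ W → NbrsIn W x v t → t ∈ B → t ≢ v → Threat B

    threat : ∀ {B} → IsBlock G W B → Threat B
    threat {B} isB with proj₂ cactus B isB
    ... | inj₂ e with k₂-other isB e
    ...   | u , u∈ , u≢ , _ , only = leaf u (proj₁ isB u∈) (k₂-leaf isB u∈ u≢ only)
    threat {B} isB | inj₁ (ℕ.suc (ℕ.suc (ℕ.suc j)) , s≤s (s≤s (s≤s _)) , ic) =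
      fork (g 1) (g 2) (B⊆U (g-∈ 1)) (subst (λ r → NbrsIn W (g 1) r (g 2)) root (nbrs 0 (s≤s (s≤s z≤n))))
        (g-∈ 2) (≢root 1 (s≤s (s≤s (s≤s z≤n))))
      where open LobeFacts (block-lobe isB) (rootAt ic (centre B isB))

    -- Staller plays the centre, which creates a threat in every cycle block; the saving answers in
    -- two blocks differ because the blocks share only `v`. A `K₂` is lost by that single move.
    star-S : AtLeastTwoBlocks G W → SW W W S-turn
    star-S (B₁ , B₂ , isB₁ , isB₂ , B₁≢B₂) with threat isB₁ | threat isB₂
    ... | leaf x x∈ h | _ = threat₁ x∈ h
    ... | fork _ _ _ _ _ _ | leaf x x∈ h = threat₁ x∈ h
    ... | fork x t x∈ h t∈ t≢v | fork x′ t′ x′∈ h′ t′∈ _ = doubleThreat x∈ x′∈ h h′ λ { refl →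
            B₁≢B₂ (block-unique isB₁ isB₂ t≢v t∈ t′∈ (centre B₁ isB₁) (centre B₂ isB₂)) }

    -- After Dominator's move at v, each vertex x not adjacent to v is dominated through a pair {y , z}.
    -- A vertex that has one of y, z as a neighbour is v, is adjacent to v or has both as neighbours,
    -- so any two such pairs are equal or disjoint.
    record Guard (y z : Fin n) : Set where
      field
        y≢z : y ≢ z
        y∈  : y ∈ W - v
        z∈  : z ∈ W - v
        near : ∀ {s} → s ≡ y ⊎ s ≡ z → ∀ {x} → x ∈ W → s ~ x → x ~ v ⊎ x ≡ v ⊎ (x ~ y × x ~ z)

    -- A pair guarding the centre itself, which Dominator's move at `v` leaves undominated. It is
    -- the reason for requiring a triangle, a 4-cycle or two copies of `K₂`.
    Special : Set
    Special = ∃ λ y → ∃ λ z → Guard y z × v ~ y × v ~ z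

    guard : ∀ {y z} → y ≢ z → y ∈ W → y ≢ v → z ∈ W → z ≢ v
          → (∀ {x} → x ∈ W → y ~ x → x ~ v ⊎ x ≡ v ⊎ (x ~ y × x ~ z))
          → (∀ {x} → x ∈ W → z ~ x → x ~ v ⊎ x ≡ v ⊎ (x ~ y × x ~ z)) → Guard y z
    guard y≢z y∈ y≢ z∈ z≢ hy hz = record
      { y≢z = y≢z ; y∈ = x∈p∧x≢y⇒x∈p-y y∈ y≢ ; z∈ = x∈p∧x≢y⇒x∈p-y z∈ z≢
      ; near = λ { (inj₁ refl) → hy ; (inj₂ refl) → hz } }

    module Square {B : Subset n} (isB : IsBlock G W B) (ic : InducesCycle G 4 B) where
      open LobeFacts (block-lobe isB) (rootAt ic (centre B isB)) public
      square : Guard (g 1) (g 3)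
      square = guard (distinct 1 3 lt lt λ ()) (B⊆U (g-∈ 1)) (≢root 0 lt) (B⊆U (g-∈ 3)) (≢root 2 lt)
        (λ x∈ a → [ (λ e → inj₂ (inj₁ (trans e root))) , (λ { refl → inj₂ (inj₂ (~-sym (adj 1) , adj 2)) }) ]′ (nbrs 0 lt a x∈))
        (λ x∈ a → [ (λ { refl → inj₂ (inj₂ (~-sym (adj 1) , adj 2)) }) , (λ e → inj₂ (inj₁ (trans e (trans wrap root)))) ]′ (nbrs 2 lt a x∈))

    special : HasCycle G W 3 ⊎ HasCycle G W 4 ⊎ (Σ (Subset n) λ B₁ → Σ (Subset n) λ B₂ →
                IsBlock G W B₁ × IsBlock G W B₂ × B₁ ≢ B₂ × IsK2 G B₁ × IsK2 G B₂) → Special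
    special (inj₁ h) with cycleBlock h
    ... | B , isB , ic = g 1 , g 2 , guard (distinct 1 2 lt lt λ ()) (B⊆U (g-∈ 1)) (≢root 0 lt) (B⊆U (g-∈ 2)) (≢root 1 lt)
        (λ x∈ a → [ (λ e → inj₂ (inj₁ (trans e root))) , (λ { refl → inj₁ (~-sym v~2) }) ]′ (nbrs 0 lt a x∈))
        (λ x∈ a → [ (λ { refl → inj₁ (~-sym v~1) }) , (λ e → inj₂ (inj₁ (trans e (trans wrap root)))) ]′ (nbrs 1 lt a x∈))
        , v~1 , v~2
      where
      open LobeFacts (block-lobe isB) (rootAt ic (centre B isB))
      v~1 : v ~ g 1
      v~1 = subst (_~ g 1) root (adj 0)
      v~2 : v ~ g 2
      v~2 = subst (_~ g 2) (trans wrap root) (~-sym (adj 2))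
    special (inj₂ (inj₁ h)) with cycleBlock h
    ... | B , isB , ic = g 1 , g 3 , square , subst (_~ g 1) root (adj 0) , subst (_~ g 3) (trans wrap root) (~-sym (adj 3))
      where open Square isB ic
    special (inj₂ (inj₂ (B₁ , B₂ , isB₁ , isB₂ , B₁≢B₂ , e₁ , e₂))) with k₂-other isB₁ e₁ | k₂-other isB₂ e₂
    ... | u , u∈ , u≢ , u~v , only | u′ , u′∈ , u′≢ , u′~v , only′ = u , u′
        , guard (λ { refl → B₁≢B₂ (block-unique isB₁ isB₂ u≢ u∈ u′∈ (centre B₁ isB₁) (centre B₂ isB₂)) })
            (proj₁ isB₁ u∈) u≢ (proj₁ isB₂ u′∈) u′≢
            (λ x∈ a → inj₂ (inj₁ (k₂-leaf isB₁ u∈ u≢ only a x∈)))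
            (λ x∈ a → inj₂ (inj₁ (k₂-leaf isB₂ u′∈ u′≢ only′ a x∈)))
        , ~-sym u~v , ~-sym u′~v

    module _ {y₀ z₀ : Fin n} (guard₀ : Guard y₀ z₀) (v~y₀ : v ~ y₀) (v~z₀ : v ~ z₀) where

      data P (x y z : Fin n) : Set where
        atCentre : x ≡ v → y ≡ y₀ → z ≡ z₀ → P x y z
        offCentre : x ∈ W → x ≢ v → ¬ x ~ v → x ~ y → x ~ z → NbrsIn W x y z → Guard y z → P x y z

      P-adj : ∀ {x y z} → P x y z → x ~ y × x ~ z × y ≢ z
      P-adj (atCentre refl refl refl) = v~y₀ , v~z₀ , Guard.y≢z guard₀
      P-adj (offCentre _ _ _ a b _ gd) = a , b , Guard.y≢z gd

      both : ∀ {y z s x′ y′ z′} → Guard y z → s ≡ y ⊎ s ≡ z → s ≡ y′ ⊎ s ≡ z′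
           → x′ ∈ W → x′ ≢ v → ¬ x′ ~ v → x′ ~ y′ → x′ ~ z′ → x′ ~ y × x′ ~ z
      both gd e e′ x′∈ x′≢ x′≁ a b with Guard.near gd e x′∈ (~-sym ([ (λ { refl → a }) , (λ { refl → b }) ]′ e′))
      ... | inj₁ c = contradiction c x′≁
      ... | inj₂ (inj₁ c) = contradiction c x′≢
      ... | inj₂ (inj₂ c) = c

      P-share : ∀ {x y z x′ y′ z′ s} → P x y z → P x′ y′ z′ → s ≡ y ⊎ s ≡ z → s ≡ y′ ⊎ s ≡ z′
              → x′ ~ y × x′ ~ z
      P-share (atCentre refl refl refl) (atCentre refl _ _) _ _ = v~y₀ , v~z₀
      P-share (atCentre refl refl refl) (offCentre x′∈ x′≢ x′≁ a b _ _) e e′ = both guard₀ e e′ x′∈ x′≢ x′≁ a b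
      P-share (offCentre _ _ _ _ _ _ gd) (offCentre x′∈ x′≢ x′≁ a b _ _) e e′ = both gd e e′ x′∈ x′≢ x′≁ a b
      -- A shared vertex makes `x` adjacent to both `y₀` and `z₀`; as `x` has no neighbours besides
      -- `y` and `z`, the two pairs coincide. This happens for the vertex opposite `v` in a 4-cycle
      -- whose pair also guards `v`.
      P-share {y = y} {z} (offCentre x∈ x≢ x≁ a b h _) (atCentre refl refl refl) e e′
        with both guard₀ e′ e x∈ x≢ x≁ a b
      ... | c , d with h c (-∈ (Guard.y∈ guard₀)) | h d (-∈ (Guard.z∈ guard₀))
      ...   | inj₁ refl | inj₂ refl = v~y₀ , v~z₀
      ...   | inj₂ refl | inj₁ refl = v~z₀ , v~y₀
      ...   | inj₁ refl | inj₁ e″ = contradiction (sym e″) (Guard.y≢z guard₀)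
      ...   | inj₂ refl | inj₂ e″ = contradiction (sym e″) (Guard.y≢z guard₀)

      open Pairing P P-adj P-share

      guarded : ∀ {x} → x ∈ W → ¬ x ~ v → ∃ λ y → ∃ λ z → P x y z × Guard y z
      guarded {x} x∈ x≁v with x ≟ v
      ... | yes refl = y₀ , z₀ , atCentre refl refl refl , guard₀
      ... | no x≢v with vertex-block x∈
      ...   | B , isB , x∈B with blockShape isB
      ...     | k₂ e with k₂-other isB e
      ...       | u , _ , _ , u~v , only with only x∈B x≢v
      ...         | refl = contradiction u~v x≁v
      guarded {x} x∈ x≁v | no x≢v | B , isB , x∈B | c₃ ic = ⊥-elim (by (cover x∈B))
        where
        open LobeFacts (block-lobe isB) (rootAt ic (centre B isB))
        by : (∃ λ i → i < 3 × g i ≡ x) → ⊥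
        by (0 , _ , e) = x≢v (trans (sym e) root)
        by (1 , _ , refl) = x≁v (subst (g 1 ~_) root (~-sym (adj 0)))
        by (2 , _ , refl) = x≁v (subst (g 2 ~_) (trans wrap root) (adj 2))
        by (ℕ.suc (ℕ.suc (ℕ.suc _)) , s≤s (s≤s (s≤s ())) , _)
      guarded {x} x∈ x≁v | no x≢v | B , isB , x∈B | c₄ ic = by (cover x∈B)
        where
        open Square isB ic
        by : (∃ λ i → i < 4 × g i ≡ x) → ∃ λ y → ∃ λ z → P x y z × Guard y z
        by (0 , _ , e) = contradiction (trans (sym e) root) x≢v
        by (1 , _ , refl) = contradiction (subst (g 1 ~_) root (~-sym (adj 0))) x≁v
        by (2 , _ , refl) = g 1 , g 3 , offCentre x∈ x≢v x≁v (~-sym (adj 1)) (adj 2) (nbrs 1 lt) square , square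
        by (3 , _ , refl) = contradiction (subst (g 3 ~_) (trans wrap root) (adj 3)) x≁v
        by (ℕ.suc (ℕ.suc (ℕ.suc (ℕ.suc _))) , s≤s (s≤s (s≤s (s≤s ()))) , _)
      guarded {x} x∈ x≁v | no x≢v | B , isB , x∈B | c₅ ic = by (cover x∈B)
        where
        open LobeFacts (block-lobe isB) (rootAt ic (centre B isB))
        1~v : g 1 ~ v
        1~v = subst (g 1 ~_) root (~-sym (adj 0))
        4~v : g 4 ~ v
        4~v = subst (g 4 ~_) (trans wrap root) (adj 4)
        -- In a pentagon `g 2` and `g 3` remain undominated; their neighbourhoods are disjoint, and
        -- the vertices `g 1` and `g 4` are already dominated by `v`.
        gd₂ : Guard (g 1) (g 3)
        gd₂ = guard (distinct 1 3 lt lt λ ()) (B⊆U (g-∈ 1)) (≢root 0 lt) (B⊆U (g-∈ 3)) (≢root 2 lt)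
          (λ x∈ a → [ (λ e → inj₂ (inj₁ (trans e root))) , (λ { refl → inj₂ (inj₂ (~-sym (adj 1) , adj 2)) }) ]′ (nbrs 0 lt a x∈))
          (λ x∈ a → [ (λ { refl → inj₂ (inj₂ (~-sym (adj 1) , adj 2)) }) , (λ { refl → inj₁ 4~v }) ]′ (nbrs 2 lt a x∈))
        gd₃ : Guard (g 2) (g 4)
        gd₃ = guard (distinct 2 4 lt lt λ ()) (B⊆U (g-∈ 2)) (≢root 1 lt) (B⊆U (g-∈ 4)) (≢root 3 lt)
          (λ x∈ a → [ (λ { refl → inj₁ 1~v }) , (λ { refl → inj₂ (inj₂ (~-sym (adj 2) , adj 3)) }) ]′ (nbrs 1 lt a x∈))
          (λ x∈ a → [ (λ { refl → inj₂ (inj₂ (~-sym (adj 2) , adj 3)) }) , (λ e → inj₂ (inj₁ (trans e (trans wrap root)))) ]′ (nbrs 3 lt a x∈))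
        by : (∃ λ i → i < 5 × g i ≡ x) → ∃ λ y → ∃ λ z → P x y z × Guard y z
        by (0 , _ , e) = contradiction (trans (sym e) root) x≢v
        by (1 , _ , refl) = contradiction 1~v x≁v
        by (2 , _ , refl) = g 1 , g 3 , offCentre x∈ x≢v x≁v (~-sym (adj 1)) (adj 2) (nbrs 1 lt) gd₂ , gd₂
        by (3 , _ , refl) = g 2 , g 4 , offCentre x∈ x≢v x≁v (~-sym (adj 2)) (adj 3) (nbrs 2 lt) gd₃ , gd₃
        by (4 , _ , refl) = contradiction 4~v x≁v
        by (ℕ.suc (ℕ.suc (ℕ.suc (ℕ.suc (ℕ.suc _)))) , s≤s (s≤s (s≤s (s≤s (s≤s ())))) , _)

      star-D : ¬ SW W W D-turn
      star-D s = ∉⊥ (proj₂ (SW⇒nonempty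
        (pairing {F′ = ∅} {A′ = ∅} (λ z∈ → contradiction z∈ ∉⊥) inv (SW-afterD v∈W s))))
        where
        inv : ∀ x → x ∈ W ─ N v → Paired (W - v) ∅ ∅ x
        inv x x∈ with guarded (─-∈ x∈) (∈─N⁻ x∈)
        ... | y , z , p , gd = inj₂ (y , z , p , (Guard.y∈ gd , Guard.z∈ gd) , ∉⊥ , ∉⊥)

  nStar-S : ∀ {W} → NStarCactus G W → SW W W S-turn
  nStar-S (inj₁ ic) = triangle-S ic
  nStar-S (inj₂ ((cactus , v , v∈ , centre) , two , short , _)) = star-S cactus v∈ centre short two

  nStar-D : ∀ {W} → NStarCactus G W → ¬ SW W W D-turn
  nStar-D (inj₁ ic) = triangle-D ic
  nStar-D (inj₂ ((cactus , v , v∈ , centre) , _ , short , win)) =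
    let (_ , _ , gd , v~y , v~z) = special cactus v∈ centre short win in
    star-D cactus v∈ centre short gd v~y v~z

  staWins : ∀ {t} → SW ⊤ ⊤ t → StaWins G (start G) t
  staWins = SW⇒StaWins Rep-start

  domWins : ∀ {t} → ¬ SW ⊤ ⊤ t → DomWins G (start G) t
  domWins = ¬SW⇒DomWins Rep-start

  C4Partition⇒IsD : C4Partition G → IsD G
  C4Partition⇒IsD c = domWins (C4Partition⇒¬SW c ∘ SW-D⇒S) , domWins (C4Partition⇒¬SW c)

  NReducible : Set
  NReducible = Σ (Subset n) λ W → Reduces G ⊤ W × NStarCactus G W

  NReducible⇒IsN : NReducible → IsN G
  NReducible⇒IsN (W , r , ns) = domWins (nStar-D ns ∘ Reduces-D r) , staWins (Reduces-S r (nStar-S ns))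

  data Class : Set where
    𝒟 : C4Partition G → Class
    𝒩 : NReducible → Class
    𝒮 : IsS G → Class

  classify : Cactus G ⊤ → Class
  classify cactus with trichotomy cactus ⊤
  ... | tiled r e = 𝒟 (Reduces⇒C4Partition r e)
  ... | first r ns = 𝒩 (_ , r , ns)
  ... | staller s = 𝒮 (staWins s , staWins (SW-D⇒S s))

  -- The classification names a class for `G`; every other class is refuted by a game that both
  -- players would win.
  D⇒C4Partition : Cactus G ⊤ → IsD G → C4Partition G
  D⇒C4Partition cactus (d , d′) with classify cactus
  ... | 𝒟 c = c
  ... | 𝒩 r = contradiction (proj₂ (NReducible⇒IsN r)) (DomWins⇒¬StaWins d′)
  ... | 𝒮 (s , _) = contradiction s (DomWins⇒¬StaWins d)

  N⇒NReducible : Cactus G ⊤ → IsN G → NReducible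
  N⇒NReducible cactus (d , s) with classify cactus
  ... | 𝒟 c = contradiction s (DomWins⇒¬StaWins (proj₂ (C4Partition⇒IsD c)))
  ... | 𝒩 r = r
  ... | 𝒮 (s′ , _) = contradiction s′ (DomWins⇒¬StaWins d)

  otherwise-S : Cactus G ⊤ → ¬ C4Partition G → ¬ NReducible → IsS G
  otherwise-S cactus nc nr with classify cactus
  ... | 𝒟 c = contradiction c nc
  ... | 𝒩 r = contradiction r nr
  ... | 𝒮 s = s

theorem5p4 : (G : Graph) → Cactus G ⊤ → AtLeastTwoBlocks G ⊤ →
    (IsD G ⇔ C4Partition G)
    × (IsN G ⇔ Σ (Subset (Graph.n G)) (λ W → Reduces G ⊤ W × NStarCactus G W))
    × (¬ C4Partition G
    → ¬ Σ (Subset (Graph.n G)) (λ W → Reduces G ⊤ W × NStarCactus G W)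
    → IsS G)
theorem5p4 G cactus _ =
  mk⇔ (D⇒C4Partition G cactus) (C4Partition⇒IsD G)
  , mk⇔ (N⇒NReducible G cactus) (NReducible⇒IsN G)
  , otherwise-S G cactus
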